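{- Let $(T,+)$ be a commutative Hausdorff semitopological semigroup and let $S$ be a dense subsemigroup of $T$. Let $\mathcal{B}$ be a countable local base with the $\mathbf{F}$ property at the point $e\in E(T)$. Let $\vec{a}=\langle a_0,a_1,\dots,a_l\rangle$ be a compressed sequence in $\mathbb{N}$ with $l>0$, let $C$ be a Milliken–Taylor matrix for $\vec{a}$, and for each $t<\omega$ let $B_t$ be a $u_t\times v_t$ finite matrix with entries from $\omega$ which is image partition regular over $\mathbb{N}$. Then any insertion matrix of $\langle B_t\rangle_{t<\omega}$ into $C$ is image partition regular over $S$ near $e$ ($IPR/S_e$).
   Context: $\omega=\{0,1,2,\dots\}$, $\mathbb{N}=\{1,2,\dots\}$. A semitopological semigroup is a semigroup with a topology for which the operation is separately continuous. $E(T)=\{e\in T: e+e=e\}$. For $x\in T$, $\tau_x$ is the collection of all sets $U\subseteq T$ with $x\in \mathrm{int}_T(U)$. $\mathbf{F}$ property: for a sequence, $FS(\langle x_n\rangle_{n=k}^{l})$ is the set of all $\sum_{n\in F}x_n$ with $F$ a nonempty subset of $\{k,\dots,l\}$; $\sum_{n=1}^\infty x_n$ converges near $e$ if for each $U\in\tau_e$ there is $m\in\mathbb{N}$ such that $FS(\langle x_n\rangle_{n=k}^{l})\subseteq U$ for all $l>k\ge m$. A countable local base $\mathcal{B}=\{U_n:n\in\mathbb{N}\}$ at $e$ has the $\mathbf{F}$ property at $e$ if (i) $\{V\in\mathcal{B}: y\in V\}$ is finite for each $y\in T\setminus\{e\}$; (ii) $U_{n+1}\subseteq U_n$ and $U_{n+1}+U_{n+1}\subseteq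 U_n$ for each $n$; (iii) for every sequence with $x_n\in U_n$ for all $n$, $\sum_{n=1}^\infty x_n$ converges near $e$. Image partition regularity over $\mathbb{N}$: a $u\times v$ matrix $M$ is image partition regular over $\mathbb{N}$ if whenever $r\in\mathbb{N}$ and $\mathbb{N}=\bigcup_{i=1}^rA_i$, there are $i\in\{1,\dots,r\}$ and $\vec{x}\in\mathbb{N}^v$ with $M\vec{x}\in A_i^u$. Products over $S$: for $c\in\mathbb{N}$, $s\in S$, $cs=s+\dots+s$ ($c$ times). For a nonzero row with entries in $\omega$, finitely many nonzero, the corresponding entry of $M\vec{x}$ is the sum of $m_jx_j$ over the $j$ with $m_j\ne0$. Near $e$: an $\omega\times\omega$ matrix $M$ is $IPR/S_e$ if whenever $r\in\mathbb{N}$ and $S=\bigcup_{i=1}^rA_i$, there is $i\in\{1,\dots,r\}$ such that for every $U\in\tau_e$ there exists $\vec{x}=\langle x_n\rangle_{n<\omega}\in S^\omega$ with $\lim_{n\to\infty}x_n=e$ and all entries of $M\vec{x}$ in $A_i\cap U$. Compressed sequences and Milliken–Taylor matrices: for a finite or infinite sequence $\vec{a}$ in $\omega$ with only finitely many nonzero entries, its compressed form $c(\vec{a})$ is obtained by deleting all zeros and then deleting all adjacent repeated entries; $\vec{a}$ is compressed if $\vec{a}=c(\vec{a})$. A Milliken–Taylor matrix for a compressed sequence $\vec{a}$ in $\mathbb{N}$ is an $\omega\times\omega$ matrix whose rows are all possible rows with entries in $\omega$, finitely many nonzero, having compressed form $\vec{a}$. Insertion matrices: let $\gamma,\delta\in\omega\cup\{\omega\}$,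 let $C=(c_{i,t})$ be a $\gamma\times\delta$ matrix with finitely many nonzero entries in each row, and for each $t<\delta$ let $B_t$ be a finite $u_t\times v_t$ matrix with $k$-th row $\vec{b}^{(t)}_k$, $k\in\{0,\dots,u_t-1\}$. Let $R=\{(i,j): i<\gamma,\ j\in\times_{t<\delta}\{0,1,\dots,u_t-1\}\}$. $D$ is an insertion matrix of $\langle B_t\rangle_{t<\delta}$ into $C$ iff the rows of $D$ are all rows of the form $c_{i,0}\cdot\vec{b}^{(0)}_{j(0)}\frown c_{i,1}\cdot\vec{b}^{(1)}_{j(1)}\frown\cdots$ with $(i,j)\in R$, where $\frown$ denotes concatenation (repeated rows may be listed once). -}

module Defs where

open import Algebra.Core using (Op₂)
open import Algebra.Structures using (IsSemigroup)
open import Data.Fin.Base using (Fin; toℕ)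
open import Data.List.Base
  using (List; []; _∷_; applyUpTo; derun; filter; map; mapMaybe; replicate; sum; tabulate; upTo)
open import Data.List.NonEmpty using (foldr₁) renaming (_∷_ to _∷⁺_)
open import Data.List.Relation.Binary.Sublist.Propositional using () renaming (_⊆_ to _⊑_)
open import Data.List.Relation.Unary.Any using (Any)
open import Data.Maybe.Base using (Maybe; just; nothing)
open import Data.Nat.Base using (ℕ; _+_; _*_; _∸_; _≤_; _<_; suc)
open import Data.Nat.Properties using (_≟_)
open import Data.Product.Base using (Σ-syntax; ∃; _×_)
open import Level using (Level; 0ℓ) renaming (suc to lsuc)
open import Relation.Binary.PropositionalEquality using (_≡_; _≢_)
open import Relation.Nullary using (¬?)
open import Relation.Unary
  using (Pred; _∈_; _⊆_; _≐_; _∩_; _⊢_; ⋃; Satisfiable; Empty)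
open import Relation.Unary.Polymorphic using (U)

private
  variable
    ℓ : Level

Subset : Set ℓ → Set (lsuc ℓ)
Subset {ℓ} X = Pred X ℓ

record Topology (X : Set ℓ) : Set (lsuc ℓ) where
  field
    Open      : Pred (Subset X) ℓ
    -- Openness depends only on the extension of a predicate.
    Open-resp : ∀ {V W} → V ≐ W → Open V → Open W
    -- Openness of ∅ is the case of an empty index type in Open-⋃.
    Open-U    : Open U
    Open-∩    : ∀ {V W} → Open V → Open W → Open (V ∩ W)
    Open-⋃    : ∀ {I : Set ℓ} {V : I → Subset X} → (∀ i → Open (V i)) → Open (⋃ I V)

  -- A ∈ τ x  iff  x ∈ int A, the interior being the union of the open
  -- subsets of A.
  τ : X → Pred (Subset X) (lsuc ℓ)
  τ x A = ∃ λ V → Open V × x ∈ V × V ⊆ A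

  Hausdorff : Set (lsuc ℓ)
  Hausdorff = ∀ {x y} → x ≢ y →
    ∃ λ V → ∃ λ W → Open V × Open W × x ∈ V × y ∈ W × Empty (V ∩ W)

  Dense : Subset X → Set (lsuc ℓ)
  Dense S = ∀ {V} → Open V → Satisfiable V → Satisfiable (V ∩ S)

  _⟶_ : (ℕ → X) → X → Set (lsuc ℓ)
  x ⟶ y = ∀ {V} → V ∈ τ y → ∃ λ N → ∀ n → N ≤ n → x n ∈ V

  Continuous : (X → X) → Set (lsuc ℓ)
  Continuous f = ∀ {V} → Open V → Open (f ⊢ V)

record SemitopologicalSemigroup (ℓ : Level) : Set (lsuc ℓ) where
  infixl 6 _⊕_
  field
    Carrier     : Set ℓ
    _⊕_         : Op₂ Carrier
    isSemigroup : IsSemigroup _≡_ _⊕_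
    topology    : Topology Carrier
  open Topology topology public
  field
    ⊕-continuousʳ : ∀ x → Continuous (λ y → x ⊕ y)
    ⊕-continuousˡ : ∀ x → Continuous (λ y → y ⊕ x)

Matrix : ℕ → ℕ → Set
Matrix u v = Fin u → Fin v → ℕ

ω×ω-Matrix : Set
ω×ω-Matrix = ℕ → ℕ → ℕ

_·_ : ∀ {u v} → Matrix u v → (Fin v → ℕ) → (Fin u → ℕ)
(M · x) k = sum (tabulate λ j → M k j * x j)

-- The subsets A i cover exactly {1,2,…}, so they are subsets of it.
ImagePartitionRegular : ∀ {u v} → Matrix u v → Set₁
ImagePartitionRegular {u} {v} M =
  (r : ℕ) → 1 ≤ r → (A : Fin r → Pred ℕ 0ℓ) → (1 ≤_) ≐ ⋃ (Fin r) A →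
  Σ[ i ∈ Fin r ] Σ[ x ∈ (Fin v → ℕ) ] (∀ j → 1 ≤ x j) × (∀ k → (M · x) k ∈ A i)

ZeroFrom : ℕ → (ℕ → ℕ) → Set
ZeroFrom N a = ∀ n → N ≤ n → a n ≡ 0

compress : List ℕ → List ℕ
compress xs = derun _≟_ (filter (λ n → ¬? (n ≟ 0)) xs)

Compressed : List ℕ → Set
Compressed a = a ≡ compress a

-- compress ignores zeros, so the choice of the bound N is immaterial.
HasCompressedForm : (ℕ → ℕ) → List ℕ → Set
HasCompressedForm b a = ∃ λ N → ZeroFrom N b × compress (applyUpTo b N) ≡ a

-- Rows may be listed repeatedly: only the set of rows is prescribed.
MillikenTaylor : List ℕ → ω×ω-Matrix → Set
MillikenTaylor a C =
  (∀ i → HasCompressedForm (C i) a) ×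
  (∀ b → HasCompressedForm b a → ∃ λ i → ∀ n → C i n ≡ b n)

-- d is the concatenation of the blocks b 0, b 1, …; block t occupies the
-- v t positions starting at v 0 + ⋯ + v (t ∸ 1).  When all v t are
-- positive, every position is covered and d is determined.
IsConcatenation : (v : ℕ → ℕ) → ((t : ℕ) → Fin (v t) → ℕ) → (ℕ → ℕ) → Set
IsConcatenation v b d = ∀ t (k : Fin (v t)) → d (sum (applyUpTo v t) + toℕ k) ≡ b t k

IsInsertionMatrix : (u v : ℕ → ℕ) → ((t : ℕ) → Matrix (u t) (v t)) →
                    ω×ω-Matrix → ω×ω-Matrix → Set
IsInsertionMatrix u v B C D =
  (∀ n → ∃ λ i → ∃ λ j → IsRow i j (D n)) × (∀ i j → ∃ λ n → IsRow i j (D n))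
  where
  IsRow : ℕ → ((t : ℕ) → Fin (u t)) → (ℕ → ℕ) → Set
  IsRow i j = IsConcatenation v (λ t k → C i t * B t (j t) k)

module _ (T : SemitopologicalSemigroup ℓ) where
  open SemitopologicalSemigroup T

  Subsemigroup : Subset Carrier → Set ℓ
  Subsemigroup S = ∀ {x y} → x ∈ S → y ∈ S → x ⊕ y ∈ S

  -- T need not have an identity, so the empty sum has no value.
  ∑ : List Carrier → Maybe Carrier
  ∑ []       = nothing
  ∑ (x ∷ xs) = just (foldr₁ _⊕_ (x ∷⁺ xs))

  -- FS x k l is FS(⟨xₙ⟩ₙ₌ₖˡ).  A subset F of {k,…,l} is a sublist of the
  -- increasing enumeration of {k,…,l}; it is nonempty as its sum exists.
  FS : (ℕ → Carrier) → ℕ → ℕ → Subset Carrier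
  FS x k l y = ∃ λ F → F ⊑ applyUpTo (k +_) (suc l ∸ k) × ∑ (map x F) ≡ just y

  SumConvergesNear : Carrier → (ℕ → Carrier) → Set (lsuc ℓ)
  SumConvergesNear e x = ∀ {V} → V ∈ τ e →
    ∃ λ m → ∀ k l → m ≤ k → k < l → FS x k l ⊆ V

  -- The base is enumerated from 0 rather than from 1.
  LocalBase : Carrier → (ℕ → Subset Carrier) → Set (lsuc ℓ)
  LocalBase e B = (∀ n → B n ∈ τ e) × (∀ {V} → V ∈ τ e → ∃ λ n → B n ⊆ V)

  record FProperty (e : Carrier) (B : ℕ → Subset Carrier) : Set (lsuc ℓ) where
    field
      -- Finiteness concerns the set of members of the base, not the set
      -- of their indices.
      finite    : ∀ y → y ≢ e →
                  ∃ λ (Vs : List (Subset Carrier)) → ∀ n → y ∈ B n → Any (B n ≐_) Vs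
      decrease  : ∀ n → B (suc n) ⊆ B n
      halve     : ∀ n {x y} → x ∈ B (suc n) → y ∈ B (suc n) → x ⊕ y ∈ B n
      converge  : ∀ x → (∀ n → x n ∈ B n) → SumConvergesNear e x

  multiple : ℕ → Carrier → Maybe Carrier
  multiple c s = ∑ (replicate c s)

  -- mapMaybe drops the terms with m j = 0.  The relation has no solution
  -- y when the row m is zero, and exactly one when m is nonzero with
  -- finitely many nonzero entries.
  IsEntry : (ℕ → ℕ) → (ℕ → Carrier) → Carrier → Set ℓ
  IsEntry m x y = ∃ λ N → ZeroFrom N m ×
    ∑ (mapMaybe (λ j → multiple (m j) (x j)) (upTo N)) ≡ just y

  IPR/ : Subset Carrier → Carrier → ω×ω-Matrix → Set (lsuc ℓ)
  IPR/ S e M =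
    (r : ℕ) → 1 ≤ r → (A : Fin r → Subset Carrier) → S ≐ ⋃ (Fin r) A →
    Σ[ i ∈ Fin r ] (∀ {V} → V ∈ τ e →
      Σ[ x ∈ (ℕ → Carrier) ] (∀ n → x n ∈ S) × x ⟶ e ×
        (∀ k → ∃ λ y → IsEntry (M k) x y × y ∈ A i ∩ V))

{-# OPTIONS --safe #-}
module Submission where

-- The usual proof takes an idempotent ultrafilter p near e all of whose members contain images of every Bₜ and
-- colours by the ultrafilter a₀p + ⋯ + aₗp.  Idempotents are replaced here by proper filters that are "closed":
-- the ultrafilters extending them form a subsemigroup.  Only countably many sets matter, namely the translates of
-- the colour classes on the combinations of a fixed sequence sₙ → e.  Given a closed filter F and a colouring χ,
-- an ω-step extension makes every finite window of ψ w = lim χ (w + x) unavoidable in all closed extensions of F.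
-- Ellis' argument then applies: the ultrafilters taking χ to the orbit of ψ form a closed semigroup, hence ψ lies
-- in its own orbit, and F extends to a closed filter along which both χ (w + x) and ψ (w + x) tend to ψ w.  Doing
-- this for aₗ, …, a₀ in turn gives a colour κ and a filter from whose members the images of the Bₜ are picked
-- greedily.  The starting filter consists of the sets whose complement splits into finitely many pieces missing
-- images; it is proper by a compact form of image partition regularity, and closed because images can be added.
-- The multiples c sₙ that this uses are bounded in advance, so sₙ can be chosen with all of them near e.

open import Defs
open import Algebra.Bundles using (CommutativeMonoid)
open import Algebra.Core using (Op₂)
open import Algebra.Definitions using (Commutative; _IdempotentOn_)
import Algebra.Properties.CommutativeMonoid.Mult as Multiples
import Algebra.Properties.CommutativeMonoid.Sum as Sums
open import Algebra.Structures using (IsCommutativeMonoid; IsSemigroup)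
open import Axiom.ExcludedMiddle using (ExcludedMiddle)
open import Data.Fin.Base using (Fin; zero; suc; toℕ; fromℕ<; combine)
open import Data.Fin.Properties using (toℕ<n; toℕ-fromℕ<; toℕ-injective; fromℕ<-injective; combine-injective)
open import Data.List.Base using (List; []; _∷_; _++_; allFin; applyUpTo; concatMap; derun; filter; foldr; length; map; mapMaybe; replicate; tabulate; upTo)
open import Data.List.Membership.Propositional using (find; lose) renaming (_∈_ to _∈ₗ_)
open import Data.List.Membership.Propositional.Properties using (∈-++⁺ˡ; ∈-++⁺ʳ; ∈-++⁻; ∈-allFin; ∈-concatMap⁺; ∈-concatMap⁻; ∈-map⁺; ∈-upTo⁺; ∈-upTo⁻)
open import Data.List.Properties using (map-upTo)
open import Data.List.Relation.Unary.All as All using (All; []; _∷_)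
open import Data.List.Relation.Unary.Any using (Any; here; there)
open import Data.Maybe.Base using (Maybe; just; nothing)
open import Data.Nat.Base using (ℕ; zero; suc; _+_; _*_; _∸_; _⊔_; _≤_; _<_; _≤‴_; ≤‴-refl; ≤‴-step; z≤n; s≤s; s≤s⁻¹)
open import Data.Nat.ListAction using () renaming (sum to sumₗ)
open import Data.Nat.Properties as ℕ using (_≟_)
open import Data.Product.Base using (Σ; Σ-syntax; ∃; _×_; _,_; proj₁; proj₂)
open import Data.Sum.Base using (_⊎_; inj₁; inj₂)
open import Data.Unit.Base using (tt) renaming (⊤ to Unit)
open import Data.Unit.Polymorphic.Base using (⊤)
open import Function.Base using (_∘_; id)
open import Level using (Level; 0ℓ; Lift; lift) renaming (suc to lsuc)
open import Relation.Binary.Definitions using (DecidableEquality; tri<; tri≈; tri>)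
open import Relation.Binary.PropositionalEquality
open import Relation.Nullary using (¬_; Dec; yes; no; contradiction; ¬?)
open import Relation.Nullary.Decidable using (decidable-stable; True; toWitness; fromWitness)
open import Relation.Unary using (Pred; _∈_; _⊆_; _∩_; _≐_; ⋃; Satisfiable; ∁)

-- Filters

private
  variable
    A : Set

record Filter (A : Set) : Set₂ where
  field
    Mem       : Pred (Pred A 0ℓ) (lsuc 0ℓ)
    upward    : ∀ {P Q} → P ⊆ Q → Mem P → Mem Q
    full      : Mem (λ _ → Unit)
    meet      : ∀ {P Q} → Mem P → Mem Q → Mem (P ∩ Q)
    inhabited : ∀ {P} → Mem P → Satisfiable P

  Positive : Pred (Pred A 0ℓ) (lsuc 0ℓ)
  Positive P = ∀ Q → Mem Q → Satisfiable (Q ∩ P)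

  meet-All : ∀ {B : Set} (P : B → Pred A 0ℓ) (L : List B) → (∀ b → b ∈ₗ L → Mem (P b)) →
             Mem (λ x → ∀ b → b ∈ₗ L → P b x)
  meet-All P []      m = upward (λ _ _ ()) full
  meet-All P (b ∷ L) m = upward (λ { (p , q) _ (here refl) → p ; (p , q) _ (there i) → q _ i })
    (meet (m b (here refl)) (meet-All P L (λ c i → m c (there i))))

open Filter

infix 4 _≼_
_≼_ : Filter A → Filter A → Set₁
F ≼ G = ∀ {P} → Mem F P → Mem G P

Positive-≼ : {F G : Filter A} → F ≼ G → ∀ {P} → Mem G P → Positive F P
Positive-≼ {G = G} F≼G m Q q = inhabited G (meet G (F≼G q) m)

Positive-⊆ : (F : Filter A) → ∀ {P Q} → P ⊆ Q → Positive F P → Positive F Q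
Positive-⊆ F s p Q m = let x , a , b = p Q m in x , a , s b

-- Indexing by a set with a join lets one construction add a single set (`Unit`), the final segments
-- of ℕ (`_⊔_`) and all finite windows of a configuration (`_++_`).
adjoin : (F : Filter A) {I : Set} → I → (_∨_ : I → I → I) (S : I → Pred A 0ℓ) →
         (∀ i j → S (i ∨ j) ⊆ S i ∩ S j) → (∀ i → Positive F (S i)) → Filter A
adjoin F i₀ _∨_ S dir pos = record
  { Mem       = λ P → ∃ λ i → ∃ λ Q → Mem F Q × Q ∩ S i ⊆ P
  ; upward    = λ s (i , Q , m , t) → i , Q , m , (λ x → s (t x))
  ; full      = i₀ , _ , full F , _
  ; meet      = λ (i , Q , m , t) (i′ , Q′ , m′ , t′) → i ∨ i′ , Q ∩ Q′ , meet F m m′ ,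
                  λ ((q , q′) , s) → t (q , proj₁ (dir i i′ s)) , t′ (q′ , proj₂ (dir i i′ s))
  ; inhabited = λ (i , Q , m , t) → let x , y = pos i Q m in x , t y
  }

trivialFilter : A → Filter A
trivialFilter a = record
  { Mem       = λ P → Lift (lsuc 0ℓ) (∀ x → P x)
  ; upward    = λ s (lift m) → lift (λ x → s (m x))
  ; full      = lift _
  ; meet      = λ (lift m) (lift m′) → lift (λ x → m x , m′ x)
  ; inhabited = λ (lift m) → a , m a
  }

increasing : (F : ℕ → Filter A) → (∀ n → F n ≼ F (suc n)) → ∀ {m n} → m ≤ n → F m ≼ F n
increasing {A} F step m≤n = go (ℕ.≤⇒≤‴ m≤n)
  where
  go : ∀ {m n} → m ≤‴ n → F m ≼ F n
  go ≤‴-refl       = id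
  go (≤‴-step m<n) = λ p → go m<n (step _ p)

limit : (F : ℕ → Filter A) → (∀ n → F n ≼ F (suc n)) → Filter A
limit F step = record
  { Mem       = λ P → ∃ λ n → Mem (F n) P
  ; upward    = λ s (n , m) → n , upward (F n) s m
  ; full      = 0 , full (F 0)
  ; meet      = λ (n , m) (n′ , m′) → n ⊔ n′ ,
                  meet (F _) (increasing F step (ℕ.m≤m⊔n n n′) m) (increasing F step (ℕ.m≤n⊔m n n′) m′)
  ; inhabited = λ (n , m) → inhabited (F n) m
  }

Surjection : Set → Set
Surjection Ω = Σ (ℕ → Ω) λ e → ∀ ω → ∃ λ n → e n ≡ ω

Agree : {Ω : Set} → (Ω → A → ℕ) → (Ω → ℕ) → List Ω → Pred A 0ℓ
Agree f φ L x = ∀ ω → ω ∈ₗ L → f ω x ≡ φ ω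

Agree-++ : ∀ {Ω : Set} (f : Ω → A → ℕ) φ L L′ → Agree f φ (L ++ L′) ⊆ Agree f φ L ∩ Agree f φ L′
Agree-++ f φ L L′ a = (λ ω i → a ω (∈-++⁺ˡ i)) , (λ ω i → a ω (∈-++⁺ʳ L i))

module Classical (em : ∀ {a} → ExcludedMiddle a) where

  dne : ∀ {a} {P : Set a} → ¬ ¬ P → P
  dne = decidable-stable em

  -- Excluded middle makes every proposition equivalent to a small one.
  ⌈_⌉ : ∀ {a} → Set a → Set
  ⌈ P ⌉ = True (em {P = P})

  Positive-∁ : (F : Filter A) → ∀ {P} → ¬ Positive F P → ∃ λ Q → Mem F Q × Q ⊆ ∁ P
  Positive-∁ F ¬p = dne λ none → ¬p λ Q m → dne λ empty →
    none (Q , m , λ {x} q p → empty (x , q , p))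

  Mem-∁ : (F : Filter A) → ∀ {P} → ¬ Mem F P → Positive F (∁ P)
  Mem-∁ F ¬m Q m = dne λ empty → ¬m (upward F (λ {x} q → dne λ ¬p → empty (x , q , ¬p)) m)

  module Large (𝒞 : Filter A → Set₂) (Ω : Set) where

    -- Unavoidability: no extension of `F` in the class `𝒞` contains the complement of `P`.
    LargeSet : Filter A → Pred A 0ℓ → Set₂
    LargeSet F P = ∀ {G} → 𝒞 G → F ≼ G → Positive G P

    -- If the class of the top colour is not large, some extension in `𝒞` has a member that misses
    -- it. Above that extension the rest of `P`, which has one colour fewer, is still large.
    pigeonhole : ∀ r (f : A → ℕ) F → 𝒞 F → ∀ P → LargeSet F P → (∀ {x} → P x → f x < r) →
      ∃ λ k → ∃ λ G → 𝒞 G × F ≼ G × LargeSet G (P ∩ λ x → f x ≡ k)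
    pigeonhole zero f F cF P large b with () ← b (proj₂ (proj₂ (large cF id _ (full F))))
    pigeonhole (suc r) f F cF P large b with em {P = LargeSet F (P ∩ λ x → f x ≡ r)}
    ... | yes l = r , F , cF , id , l
    ... | no ¬l =
      let H , cH , F≼H , ¬pos = small
          Y , mY , miss = Positive-∁ H ¬pos
          k , G , cG , H≼G , l = pigeonhole r f H cH (P ∩ λ x → f x < r)
            (λ {G} cG H≼G Q m →
              let x , (q , y) , p = large cG (λ m → H≼G (F≼H m)) _ (meet G m (H≼G mY))
              in x , q , p , ℕ.≤∧≢⇒< (s≤s⁻¹ (b p)) (λ eq → miss y (p , eq)))
            proj₂
      in k , G , cG , (λ m → H≼G (F≼H m)) , λ cK G≼K Q m →
        let x , q , (p , _) , e = l cK G≼K Q m in x , q , p , e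
      where
      small : ∃ λ H → 𝒞 H × F ≼ H × ¬ Positive H (P ∩ λ x → f x ≡ r)
      small = dne λ none → ¬l λ {G} cG F≼G → dne {P = Positive G _} λ ¬pos → none (G , cG , (λ {Q} → F≼G {Q}) , ¬pos)

    module _ (limit-𝒞 : ∀ F step → (∀ n → 𝒞 (F n)) → 𝒞 (limit F step))
             (enum : Surjection Ω) (f : Ω → A → ℕ) (r : ℕ) (bounded : ∀ ω x → f ω x < r)
             (F₀ : Filter A) (c₀ : 𝒞 F₀) where

      private
        record Stage : Set₂ where
          field
            F     : Filter A
            cF    : 𝒞 F
            P     : Pred A 0ℓ
            large : LargeSet F P
        open Stage

        next : (σ : Stage) (ω : Ω) →
          ∃ λ k → Σ Stage λ σ′ → F σ ≼ F σ′ × P σ′ ⊆ P σ × (∀ {x} → P σ′ x → f ω x ≡ k)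
        next σ ω =
          let k , G , cG , F≼G , l = pigeonhole r (f ω) (F σ) (cF σ) (P σ) (large σ) (λ {x} _ → bounded ω x)
          in k , record { F = G ; cF = cG ; P = _ ; large = l } , F≼G , proj₁ , proj₂

        stage : ℕ → Stage
        stage zero    = record { F = F₀ ; cF = c₀ ; P = λ _ → Unit
                               ; large = λ {G} _ _ Q m → let x , p = inhabited G m in x , p , tt }
        stage (suc n) = proj₁ (proj₂ (next (stage n) (proj₁ enum n)))

        F↑ : ∀ n → F (stage n) ≼ F (stage (suc n))
        F↑ n = proj₁ (proj₂ (proj₂ (next (stage n) (proj₁ enum n))))

        P↓ : ∀ {m n} → m ≤ n → P (stage n) ⊆ P (stage m)
        P↓ m≤n = go (ℕ.≤⇒≤‴ m≤n)
          where
          go : ∀ {m n} → m ≤‴ n → P (stage n) ⊆ P (stage m)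
          go ≤‴-refl           p = p
          go {m} (≤‴-step m<n) p = proj₁ (proj₂ (proj₂ (proj₂ (next (stage m) (proj₁ enum m))))) (go m<n p)

        φ : Ω → ℕ
        φ ω = proj₁ (next (stage (proj₁ (proj₂ enum ω))) (proj₁ enum (proj₁ (proj₂ enum ω))))

        decided : ∀ ω → ∃ λ n → ∀ {x} → P (stage n) x → f ω x ≡ φ ω
        decided ω = suc n , λ {x} p → subst (λ ω′ → f ω′ x ≡ φ ω) (proj₂ (proj₂ enum ω))
          (proj₂ (proj₂ (proj₂ (proj₂ (next (stage n) (proj₁ enum n))))) p)
          where n = proj₁ (proj₂ enum ω)

        decidedAll : ∀ L → ∃ λ n → P (stage n) ⊆ Agree f φ L
        decidedAll []      = 0 , λ _ _ ()
        decidedAll (ω ∷ L) =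
          let m , d = decided ω ; n , ds = decidedAll L in
          m ⊔ n , λ { p _ (here refl) → d (P↓ (ℕ.m≤m⊔n m n) p)
                    ; p _ (there i)   → ds (P↓ (ℕ.m≤n⊔m m n) p) _ i }

      -- The windows are not made members, since adjoining them might leave `𝒞`. Each finite window
      -- contains the set `P` of a late stage and inherits its largeness.
      thread : ∃ λ G → 𝒞 G × F₀ ≼ G × Σ (Ω → ℕ) λ φ → ∀ L → LargeSet G (Agree f φ L)
      thread = limit (F ∘ stage) F↑ , limit-𝒞 (F ∘ stage) F↑ (λ n → cF (stage n)) , (0 ,_) , φ , λ L {G} cG ≼G →
        let n , s = decidedAll L in Positive-⊆ G s (large (stage n) cG (λ m → ≼G (n , m)))

  -- In the class of all filters large sets are positive, so the windows can be adjoined. This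
  -- replaces the choice of an ultrafilter wherever countably many colourings have to be decided.
  decide : ∀ {Ω} → Surjection Ω → (f : Ω → A → ℕ) (r : ℕ) → (∀ ω x → f ω x < r) → (F : Filter A) →
           ∃ λ G → F ≼ G × Σ (Ω → ℕ) λ φ → ∀ ω → Mem G (λ x → f ω x ≡ φ ω)
  decide {Ω = Ω} enum f r b F with Large.thread (λ _ → ⊤) Ω _ enum f r b F _
  ... | G , _ , F≼G , φ , large =
    adjoin G [] _++_ (Agree f φ) (Agree-++ f φ) (λ L → large L {G} _ id) ,
    (λ m → [] , _ , F≼G m , proj₁) , φ , λ ω → ω ∷ [] , _ , full G , λ a → proj₂ a _ (here refl)

-- Closed filters and recurrent configurations

module ClosedFilters (em : ∀ {a} → ExcludedMiddle a) {W : Set} (_∙_ : Op₂ W) where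
  open Classical em

  -- `G` may leave open whether `P (x ∙ y)` holds for most `y`; `H` is an extension that settles it
  -- for all `x` in `Q` at once.
  Shifts : Filter W → Pred W 0ℓ → Filter W → Set₂
  Shifts F P G = Σ[ H ∈ Filter W ] G ≼ H × ∃ λ Q → Mem F Q × (∀ {x} → Q x → Mem H (λ y → P (x ∙ y)))

  -- The ultrafilters extending F form a subsemigroup: G stands for an ultrafilter q above F, and P ∈ p + q for
  -- every p above F.
  Closed : Filter W → Set₂
  Closed F = ∀ {P} → Mem F P → ∀ G → F ≼ G → Shifts F P G

  closed-limit : ∀ F step → (∀ n → Closed (F n)) → Closed (limit F step)
  closed-limit F step cF (n , m) G F≼G =
    let H , G≼H , Q , mQ , s = cF n m G (λ m → F≼G (n , m)) in H , G≼H , Q , (n , mQ) , s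

  module _ (F : Filter W) (cF : Closed F) {I : Set} (i₀ : I) (_∨_ : Op₂ I) (S : I → Pred W 0ℓ)
           (dir : ∀ i j → S (i ∨ j) ⊆ S i ∩ S j) (pos : ∀ i → Positive F (S i)) where
    private
      F⁺ : Filter W
      F⁺ = adjoin F i₀ _∨_ S dir pos

    closed-adjoin : (∀ i G → F⁺ ≼ G → Shifts F⁺ (S i) G) → Closed F⁺
    closed-adjoin c (i , P , m , s) G F⁺≼G =
      let H , G≼H , Q , mQ , t = cF m G (λ m → F⁺≼G (i₀ , _ , m , proj₁))
          K , H≼K , R , mR , u = c i H (λ m → G≼H (F⁺≼G m))
      in K , (λ m → H≼K (G≼H m)) , Q ∩ R , meet F⁺ (i₀ , Q , mQ , proj₁) mR ,
         λ (q , r) → upward K s (meet K (H≼K (t q)) (u r))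

  module _ {Ω : Set} (enum : Surjection Ω) (_◃_ : Ω → W → Ω)
           (◃-assoc : ∀ ω x y → (ω ◃ x) ◃ y ≡ ω ◃ (x ∙ y)) where

    orbit : (Ω → ℕ) → Ω → W → ℕ
    orbit χ ω x = χ (ω ◃ x)

    Returns : (χ ψ : Ω → ℕ) → List Ω → Pred W 0ℓ
    Returns χ ψ = Agree (orbit χ) ψ

    returns-++ : ∀ χ ψ L L′ → Returns χ ψ (L ++ L′) ⊆ Returns χ ψ L ∩ Returns χ ψ L′
    returns-++ χ ψ = Agree-++ (orbit χ) ψ

    -- As `ψ` takes the same values on `L` and on `L` moved by `h`, a return on the moved window is
    -- a return on `L`.
    returns-shift : ∀ χ ψ L h → Returns ψ ψ L h → Returns χ ψ (map (_◃ h) L) ⊆ λ y → Returns χ ψ L (h ∙ y)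
    returns-shift χ ψ L h p {y} a ω i =
      trans (cong χ (sym (◃-assoc ω h y))) (trans (a _ (∈-map⁺ (_◃ h) i)) (p _ i))

    module Limit (F : Filter W) (cF : Closed F) (r : ℕ) (χ ψ : Ω → ℕ) (χ< : ∀ ω → χ ω < r) (ψ< : ∀ ω → ψ ω < r)
             (large : ∀ L → Large.LargeSet Closed Ω F (Returns χ ψ L)) where

      -- Positive types are the finite windows of the configurations ω ↦ lim ψ (ω ◃ x), the limit taken along
      -- an ultrafilter extending F.
      PosType : (Ω → ℕ) → List Ω → Set₁
      PosType φ L = Positive F (Returns ψ φ L)

      InOrbit : List Ω → Pred W 0ℓ
      InOrbit L y = ⌈ PosType (λ ω → χ (ω ◃ y)) L ⌉

      Typical : List Ω → Pred W 0ℓ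
      Typical L x = ⌈ PosType (λ ω → ψ (ω ◃ x)) L ⌉

      -- If the exceptional set were positive, the limit of the translates of `ψ` along a filter
      -- containing it would have positive windows, yet would agree on `L` with an exceptional
      -- translate.
      typical : ∀ L → Mem F (Typical L)
      typical L = dne λ ¬m →
        let G , F⁺≼G , φ , d = decide enum (orbit ψ) r (λ ω x → ψ< (ω ◃ x))
              (adjoin F _ (λ _ _ → _) (λ (_ : Unit) → ∁ (Typical L)) (λ _ _ x → x , x) (λ _ → Mem-∁ F ¬m))
            x , a , ¬t = inhabited G (meet G (meet-All G _ L (λ ω _ → d ω)) (F⁺≼G (_ , _ , full F , proj₂)))
        in ¬t (fromWitness (Positive-⊆ F (λ b ω i → trans (b ω i) (sym (a ω i)))
             (Positive-≼ {F = F} {G} (λ m → F⁺≼G (_ , _ , m , proj₁)) (meet-All G _ L (λ ω _ → d ω)))))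

      inOrbit-++ : ∀ L L′ → InOrbit (L ++ L′) ⊆ InOrbit L ∩ InOrbit L′
      inOrbit-++ L L′ o = fromWitness (Positive-⊆ F (λ a ω i → a ω (∈-++⁺ˡ i)) (toWitness o)) ,
                          fromWitness (Positive-⊆ F (λ a ω i → a ω (∈-++⁺ʳ L i)) (toWitness o))

      returns-large : ∀ L → Positive F (Returns χ ψ L)
      returns-large L = large L {F} cF id

      F+χ : Filter W
      F+χ = adjoin F [] _++_ (Returns χ ψ) (returns-++ χ ψ) returns-large

      -- For typical `x`, and for `y` along which `χ` tends to `ψ`, the translate of `χ` by `x ∙ y`
      -- agrees on `L` with that of `ψ` by `x`.
      inOrbit-positive : ∀ L → Positive F (InOrbit L)
      inOrbit-positive L P m =
        let H , ≼H , Q , mQ , s = cF m F+χ (λ m → [] , _ , m , proj₁)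
            x , q , t = inhabited F (meet F mQ (typical L))
            y , p , a = inhabited H (meet H (s q) (≼H (map (_◃ x) L , _ , full F , proj₂)))
        in x ∙ y , p , fromWitness (Positive-⊆ F
             (λ b ω i → trans (b ω i) (trans (sym (a _ (∈-map⁺ (_◃ x) i))) (cong χ (◃-assoc ω x y)))) (toWitness t))

      -- The ultrafilters along which χ (ω ◃ y) has the same limits as ψ (ω ◃ x) along some ultrafilter above F.
      OrbitFilter : Filter W
      OrbitFilter = adjoin F [] _++_ InOrbit inOrbit-++ inOrbit-positive

      -- Let `φ` be the limit of `χ` along `G′`. Its windows are positive, so some filter `J` above
      -- `F` takes `ψ` to `φ`. Since `F` is closed, for `F`-most `h` some `x` along `J` has `h ∙ x`
      -- typical, and there `ψ` shows the window that `χ` shows at `h ∙ y` for `G′`-most `y`.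
      closed-orbit : Closed OrbitFilter
      closed-orbit = closed-adjoin F cF [] _++_ InOrbit inOrbit-++ inOrbit-positive λ L G ≼G →
        let G′ , G≼G′ , φ , d = decide enum (orbit χ) r (λ ω y → χ< (ω ◃ y)) G
            posφ : ∀ K → PosType φ K
            posφ K =
              let y , a , o = inhabited G′ (meet G′ (meet-All G′ _ K (λ ω _ → d ω))
                                (G≼G′ (≼G (K , _ , full F , proj₂))))
              in Positive-⊆ F (λ b ω i → trans (b ω i) (a ω i)) (toWitness o)
            J = adjoin F [] _++_ (Returns ψ φ) (returns-++ ψ φ) posφ
            H , J≼H , Q , mQ , s = cF (typical L) J (λ m → [] , _ , m , proj₁)
        in G′ , G≼G′ , Q , ([] , Q , mQ , proj₁) , λ {h} q →
          let x , t , a = inhabited H (meet H (s q) (J≼H (map (_◃ h) L , _ , full F , proj₂)))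
          in upward G′ (λ {y} c → fromWitness (Positive-⊆ F (λ b ω i →
                 trans (b ω i) (trans (cong ψ (sym (◃-assoc ω h x))) (trans (a _ (∈-map⁺ (_◃ h) i))
                   (trans (sym (c _ (∈-map⁺ (_◃ h) i))) (cong χ (◃-assoc ω h y))))))
                 (toWitness t)))
               (meet-All G′ _ (map (_◃ h) L) (λ ω _ → d ω))

      -- Here it matters that the windows are unavoidable in every closed extension: `OrbitFilter`
      -- is one, so some `y` in the orbit set shows the window of `ψ` itself, which is therefore
      -- positive.
      recurrent-positive : ∀ L → Positive F (Returns ψ ψ L)
      recurrent-positive L =
        let y , o , a = large L {OrbitFilter} closed-orbit (λ m → [] , _ , m , proj₁) _ (L , _ , full F , proj₂)
        in Positive-⊆ F (λ b ω i → trans (b ω i) (a ω i)) (toWitness o)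

      private
        returns-shifts : ∀ χ′ (G : Filter W) → (∀ L → Mem G (Returns ψ ψ L)) → (∀ L → Mem G (Returns χ′ ψ L)) →
                         ∀ L H → G ≼ H → Shifts G (Returns χ′ ψ L) H
        returns-shifts χ′ G mψ mχ L H G≼H = H , id , Returns ψ ψ L , mψ L , λ {h} p →
          upward H (returns-shift χ′ ψ L h p) (G≼H (mχ (map (_◃ h) L)))

      F₁ : Filter W
      F₁ = adjoin F [] _++_ (Returns ψ ψ) (returns-++ ψ ψ) recurrent-positive

      F₁-recurrent : ∀ L → Mem F₁ (Returns ψ ψ L)
      F₁-recurrent L = L , _ , full F , proj₂

      closed₁ : Closed F₁
      closed₁ = closed-adjoin F cF [] _++_ (Returns ψ ψ) (returns-++ ψ ψ) recurrent-positive
        (returns-shifts ψ F₁ F₁-recurrent F₁-recurrent)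

      returns-large₁ : ∀ L → Positive F₁ (Returns χ ψ L)
      returns-large₁ L = large L {F₁} closed₁ (λ m → [] , _ , m , proj₁)

      -- The returns of `ψ` are adjoined first, because shifting a return of `χ` by `h` uses that
      -- `ψ` returns along `h`.
      F₂ : Filter W
      F₂ = adjoin F₁ [] _++_ (Returns χ ψ) (returns-++ χ ψ) returns-large₁

      F₁≼F₂ : F₁ ≼ F₂
      F₁≼F₂ m = [] , _ , m , proj₁

      closed₂ : Closed F₂
      closed₂ = closed-adjoin F₁ closed₁ [] _++_ (Returns χ ψ) (returns-++ χ ψ) returns-large₁
        (returns-shifts χ F₂ (λ L → F₁≼F₂ (F₁-recurrent L)) (λ L → L , _ , full F₁ , proj₂))

    IsLimit : Filter W → (χ ψ : Ω → ℕ) → Set₁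
    IsLimit G χ ψ = ∀ ω → Mem G (λ x → χ (ω ◃ x) ≡ ψ ω × ψ (ω ◃ x) ≡ ψ ω)

    limit-exists : ∀ F → Closed F → ∀ r χ → (∀ ω → χ ω < r) →
      ∃ λ G → Closed G × F ≼ G × Σ (Ω → ℕ) λ ψ → (∀ ω → ψ ω < r) × IsLimit G χ ψ
    limit-exists F₀ c₀ r χ χ< =
      let F , cF , F₀≼F , ψ , large = Large.thread Closed Ω closed-limit enum (orbit χ) r (λ ω x → χ< (ω ◃ x)) F₀ c₀
          ψ< = λ ω → let x , _ , a = large (ω ∷ []) {F} cF id _ (full F) in
                     subst (_< r) (a ω (here refl)) (χ< (ω ◃ x))
          open Limit F cF r χ ψ χ< ψ< large
      in F₂ , closed₂ , (λ m → F₁≼F₂ ([] , _ , F₀≼F m , proj₁)) , ψ , ψ< , λ ω →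
         upward F₂ (λ (a , b) → b ω (here refl) , a ω (here refl))
           (meet F₂ (F₁≼F₂ (F₁-recurrent (ω ∷ []))) (ω ∷ [] , _ , full F₁ , proj₂))

-- Image partition regularity over ℕ

·-*ʳ : ∀ {u v} (M : Matrix u v) x c k → (M · (λ j → x j * c)) k ≡ (M · x) k * c
·-*ʳ M x c k = go _ (M k) x
  where
  go : ∀ n (m x : Fin n → ℕ) → sumₗ (tabulate λ j → m j * (x j * c)) ≡ sumₗ (tabulate λ j → m j * x j) * c
  go zero    m x = refl
  go (suc n) m x = trans (cong₂ _+_ (sym (ℕ.*-assoc (m zero) (x zero) c)) (go n (m ∘ suc) (x ∘ suc)))
    (sym (ℕ.*-distribʳ-+ c (m zero * x zero) _))

product-colouring : ∀ N (f : ℕ → ℕ → ℕ) r → (∀ c m → f c m < r) →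
  ∃ λ R → Σ (ℕ → ℕ) λ g → (∀ m → g m < R) × (∀ m m′ → g m ≡ g m′ → ∀ c → c ≤ N → f c m ≡ f c m′)
product-colouring zero    f r b = r , f 0 , b 0 , λ { _ _ e .0 z≤n → e }
product-colouring (suc N) f r b with product-colouring N f r b
... | R , g , g< , inj = R * r , toℕ ∘ pair , (λ m → toℕ<n (pair m)) , same
  where
  pair : ℕ → Fin (R * r)
  pair m = combine (fromℕ< (g< m)) (fromℕ< (b (suc N) m))

  same : ∀ m m′ → toℕ (pair m) ≡ toℕ (pair m′) → ∀ c → c ≤ suc N → f c m ≡ f c m′
  same m m′ e c c≤ with combine-injective (fromℕ< (g< m)) (fromℕ< (b (suc N) m)) (fromℕ< (g< m′))
                          (fromℕ< (b (suc N) m′)) (toℕ-injective e) | c ℕ.≟ suc N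
  ... | p , q | yes refl = fromℕ<-injective _ _ (b c m) (b c m′) q
  ... | p , q | no c≢    = inj m m′ (fromℕ<-injective _ _ (g< m) (g< m′) p) c (s≤s⁻¹ (ℕ.≤∧≢⇒< c≤ c≢))

cofinite : Filter ℕ
cofinite = adjoin (trivialFilter 0) 0 _⊔_ _≤_
  (λ i j p → ℕ.≤-trans (ℕ.m≤m⊔n i j) p , ℕ.≤-trans (ℕ.m≤n⊔m i j) p)
  (λ i P (lift m) → i , m i , ℕ.≤-refl)

cofinite-≥ : ∀ n → Mem cofinite (n ≤_)
cofinite-≥ n = n , _ , full (trivialFilter 0) , proj₂

module Ladders (em : ∀ {a} → ExcludedMiddle a) (u v : ℕ → ℕ) (B : (t : ℕ) → Matrix (u t) (v t)) where
  open Classical em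

  MonoImage : (ℕ → ℕ) → ℕ → (t : ℕ) → (Fin (v t) → ℕ) → Set
  MonoImage χ κ t x = (∀ j → 1 ≤ x j) × ∀ k → 1 ≤ (B t · x) k × χ ((B t · x) k) ≡ κ

  Regular : ℕ → Set
  Regular i = ∀ r χ → (∀ n → χ n < r) → ∃ λ κ → ∀ t → t ≤ i → ∃ λ x → MonoImage χ κ t x

  -- `N` is uniform in the colouring and bounds vectors as well as images, so that later only
  -- boundedly many multiples of each point occur.
  Ladder : ℕ → ℕ → ℕ → Set
  Ladder i r N = ∀ χ → (∀ n → χ n < r) → ∃ λ κ → ∀ t → t ≤ i →
    ∃ λ x → MonoImage χ κ t x × (∀ j → x j ≤ N) × (∀ k → (B t · x) k ≤ N)

  module _ (ipr : ∀ t → ImagePartitionRegular (B t)) (row : ∀ t → Fin (u t)) where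

    regular-single : ∀ t r χ → (∀ n → χ n < r) → ∃ λ κ → ∃ λ x → MonoImage χ κ t x
    regular-single t r χ b =
      let i , x , x≥1 , m = ipr t r (ℕ.≤-trans (s≤s z≤n) (b 0)) (λ i n → 1 ≤ n × χ n ≡ toℕ i)
            ((λ {n} 1≤n → fromℕ< (b n) , 1≤n , sym (toℕ-fromℕ< (b n))) , λ (_ , 1≤n , _) → 1≤n)
      in toℕ i , x , x≥1 , m

    -- Otherwise each `N` has a bad colouring. Along a filter above the cofinite one these converge
    -- pointwise to some `φ`; the finitely many images that `φ` admits are monochromatic and bounded
    -- by `N` for one of the bad colourings.
    compactness : ∀ i → Regular i → ∀ r → ∃ (Ladder i r)
    compactness i reg r = dne ¬none
      where
      HasLadder : (ℕ → ℕ) → ℕ → Set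
      HasLadder χ N = ∃ λ κ → ∀ t → t ≤ i → ∃ λ x → MonoImage χ κ t x × (∀ j → x j ≤ N) × (∀ k → (B t · x) k ≤ N)

      module _ (χ : ℕ → ℕ → ℕ) (χ< : ∀ N n → χ N n < r) where
        Fits : (φ : ℕ → ℕ) (t : ℕ) (x : Fin (v t) → ℕ) → ℕ → Set
        Fits φ t x N = (∀ j → x j ≤ N) × (∀ k → (B t · x) k ≤ N × χ N ((B t · x) k) ≡ φ ((B t · x) k))

        fits : ∀ G → cofinite ≼ G → ∀ φ → (∀ j → Mem G (λ N → χ N j ≡ φ j)) → ∀ t x → Mem G (Fits φ t x)
        fits G cof≼G φ d t x =
          upward G (λ (p , q) → (λ j → p j (∈-allFin j)) , λ k → q k (∈-allFin k))
            (meet G (meet-All G (λ j N → x j ≤ N) (allFin (v t)) (λ j _ → cof≼G (cofinite-≥ (x j))))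
                    (meet-All G _ (allFin (u t)) (λ k _ → meet G (cof≼G (cofinite-≥ ((B t · x) k))) (d _))))

        ladder-in : ∃ λ N → HasLadder (χ N) N
        ladder-in with decide (id , λ n → n , refl) (λ j N → χ N j) r (λ j N → χ< N j) cofinite
        ... | G , cof≼G , φ , d with reg r φ (λ n → let N , e = inhabited G (d n) in subst (_< r) e (χ< N n))
        ... | κ , images with inhabited G (meet-All G (λ t N → (t≤i : t ≤ i) → Fits φ t (proj₁ (images t t≤i)) N)
                            (upTo (suc i)) (λ t t∈ → upward G
                              (λ f t≤i → subst (λ t≤i → Fits φ t (proj₁ (images t t≤i)) _) (ℕ.≤-irrelevant _ t≤i) f)
                              (fits G cof≼G φ d t (proj₁ (images t (s≤s⁻¹ (∈-upTo⁻ t∈)))))))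
        ... | N , f = N , κ , λ t t≤i → finish t (images t t≤i) (f t (∈-upTo⁺ (s≤s t≤i)) t≤i)
          where
          finish : ∀ t ((x , _) : ∃ λ x → MonoImage φ κ t x) → Fits φ t x N →
                   ∃ λ x → MonoImage (χ N) κ t x × (∀ j → x j ≤ N) × (∀ k → (B t · x) k ≤ N)
          finish t (x , x≥1 , m) (p , q) =
            x , (x≥1 , λ k → proj₁ (m k) , trans (proj₂ (q k)) (proj₂ (m k))) , p , λ k → proj₁ (q k)

      ¬none : ¬ ¬ ∃ (Ladder i r)
      ¬none none = proj₂ (proj₂ (bad (proj₁ found))) (proj₂ found)
        where
        bad : ∀ N → Σ (ℕ → ℕ) λ χ → (∀ n → χ n < r) × ¬ HasLadder χ N
        bad N = dne λ good → none (N , λ χ b → dne λ ¬κ → good (χ , b , ¬κ))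
        found = ladder-in (λ N → proj₁ (bad N)) (λ N → proj₁ (proj₂ (bad N)))

    -- Colour m by the vector of the colours of m, 2m, …, Nm: an image y of the new matrix that is monochromatic
    -- for it can be multiplied by the ladder found in the multiples of y₀.
    regular-suc : ∀ i → (∀ r → ∃ (Ladder i r)) → Regular (suc i)
    regular-suc i ladders r χ b with ladders r
    ... | N , ladder with product-colouring N (λ c m → χ (c * m)) r (λ c m → b (c * m))
    ... | R , g , g< , same with regular-single (suc i) R g g<
    ... | _ , m , m≥1 , mono with ladder (λ c → χ (c * (B (suc i) · m) (row (suc i)))) (λ c → b _)
    ... | κ , images with images 0 z≤n
    ... | x₀ , (_ , mono₀) , _ , ≤N = κ , image
      where
      y₀ = (B (suc i) · m) (row (suc i))
      -- One entry of the ladder serves as the factor for the new matrix. It is at most `N`, so the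
      -- product colouring gives `c` times every entry of the new image the colour of `c` times
      -- `y₀`, which is `κ`.
      c  = (B 0 · x₀) (row 0)

      image : ∀ t → t ≤ suc i → ∃ λ x → MonoImage χ κ t x
      image t t≤ with t ℕ.≟ suc i
      ... | yes refl =
        (λ j → m j * c) , (λ j → ℕ.*-mono-≤ (m≥1 j) (proj₁ (mono₀ (row 0)))) , λ k →
          subst (λ n → 1 ≤ n × χ n ≡ κ) (trans (ℕ.*-comm c _) (sym (·-*ʳ (B (suc i)) m c k)))
            (ℕ.*-mono-≤ (proj₁ (mono₀ (row 0))) (proj₁ (mono k)) ,
             trans (same _ y₀ (trans (proj₂ (mono k)) (sym (proj₂ (mono (row (suc i)))))) c (≤N (row 0)))
                   (proj₂ (mono₀ (row 0))))
      ... | no t≢ with images t (s≤s⁻¹ (ℕ.≤∧≢⇒< t≤ t≢))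
      ...   | x , (x≥1 , p) , _ =
        (λ j → x j * y₀) , (λ j → ℕ.*-mono-≤ (x≥1 j) (proj₁ (mono (row (suc i))))) , λ k →
          subst (λ n → 1 ≤ n × χ n ≡ κ) (sym (·-*ʳ (B t) x y₀ k))
            (ℕ.*-mono-≤ (proj₁ (p k)) (proj₁ (mono (row (suc i)))) , proj₂ (p k))

    regular : ∀ i → Regular i
    regular zero r χ b = let κ , x , m = regular-single 0 r χ b in κ , λ { .0 z≤n → x , m }
    regular (suc i) = regular-suc i (compactness i (regular i))

    ladder : ∀ i r → ∃ (Ladder i r)
    ladder i r = compactness i (regular i) r

-- Formal combinations

-- Stated for any commutative monoid because it is applied twice: to words, and to the semigroup
-- with an identity adjoined.
module LinearForms {a} {A : Set a} {_∙_ : Op₂ A} {ε : A} (isCM : IsCommutativeMonoid _≡_ _∙_ ε) where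
  monoid : CommutativeMonoid a a
  monoid = record { isCommutativeMonoid = isCM }
  open IsCommutativeMonoid isCM using (identityˡ)
  open Sums monoid public using (sum; sum-cong-≗; ∑-distrib-+)
  open Multiples monoid public using (×-homo-+; ×-assocˡ; ×-distrib-+) renaming (_×_ to _×ₘ_)

  linear : ∀ {n} → (Fin n → ℕ) → (Fin n → A) → A
  linear m x = sum λ j → m j ×ₘ x j

  linear-∙ : ∀ {n} (m : Fin n → ℕ) x y → linear m (λ j → x j ∙ y j) ≡ linear m x ∙ linear m y
  linear-∙ m x y = trans (sum-cong-≗ λ j → ×-distrib-+ (x j) (y j) (m j)) (∑-distrib-+ (λ j → m j ×ₘ x j) _)

  linear-multiples : ∀ {n} (m c : Fin n → ℕ) a →
                     linear m (λ j → c j ×ₘ a) ≡ sumₗ (tabulate λ j → m j * c j) ×ₘ a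
  linear-multiples {zero}  m c a = refl
  linear-multiples {suc n} m c a = trans
    (cong₂ _∙_ (×-assocˡ a (m zero) (c zero)) (linear-multiples (m ∘ suc) (c ∘ suc) a))
    (sym (×-homo-+ a (m zero * c zero) _))

  linear-cong-× : ∀ {n} c (m : Fin n → ℕ) x → linear (λ j → c * m j) x ≡ c ×ₘ linear m x
  linear-cong-× {zero}  c m x = sym (zeroes c)
    where
    zeroes : ∀ c → c ×ₘ ε ≡ ε
    zeroes zero    = refl
    zeroes (suc c) = trans (identityˡ _) (zeroes c)
  linear-cong-× {suc n} c m x = trans
    (cong₂ _∙_ (sym (×-assocˡ (x zero) c (m zero))) (linear-cong-× c (m ∘ suc) (x ∘ suc)))
    (sym (×-distrib-+ _ _ c))

-- Combinations of a sequence s₀, s₁, … given by their coefficients.  Trailing zeros are not removed, so a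
-- combination has several words.
Word : Set
Word = List ℕ

infixl 6 _⊹_
_⊹_ : Op₂ Word
[]       ⊹ w        = w
(c ∷ w)  ⊹ []       = c ∷ w
(c ∷ w)  ⊹ (d ∷ w′) = c + d ∷ w ⊹ w′

⊹-identityʳ : ∀ w → w ⊹ [] ≡ w
⊹-identityʳ []      = refl
⊹-identityʳ (_ ∷ _) = refl

⊹-comm : ∀ w w′ → w ⊹ w′ ≡ w′ ⊹ w
⊹-comm []      w′       = sym (⊹-identityʳ w′)
⊹-comm (c ∷ w) []       = refl
⊹-comm (c ∷ w) (d ∷ w′) = cong₂ _∷_ (ℕ.+-comm c d) (⊹-comm w w′)

⊹-assoc : ∀ w w′ w″ → (w ⊹ w′) ⊹ w″ ≡ w ⊹ (w′ ⊹ w″)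
⊹-assoc []      w′       w″       = refl
⊹-assoc (c ∷ w) []       w″       = refl
⊹-assoc (c ∷ w) (d ∷ w′) []       = refl
⊹-assoc (c ∷ w) (d ∷ w′) (e ∷ w″) = cong₂ _∷_ (ℕ.+-assoc c d e) (⊹-assoc w w′ w″)

⊹-isCommutativeMonoid : IsCommutativeMonoid _≡_ _⊹_ []
⊹-isCommutativeMonoid = record
  { isMonoid = record
    { isSemigroup = record
      { isMagma = record { isEquivalence = isEquivalence ; ∙-cong = cong₂ _⊹_ }
      ; assoc   = ⊹-assoc
      }
    ; identity = (λ _ → refl) , ⊹-identityʳ
    }
  ; comm = ⊹-comm
  }

module W = LinearForms ⊹-isCommutativeMonoid

coeff : Word → ℕ → ℕ
coeff []      _       = 0
coeff (c ∷ w) zero    = c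
coeff (c ∷ w) (suc i) = coeff w i

coeff-⊹ : ∀ w w′ i → coeff (w ⊹ w′) i ≡ coeff w i + coeff w′ i
coeff-⊹ []      w′       i       = refl
coeff-⊹ (c ∷ w) []       i       = sym (ℕ.+-identityʳ _)
coeff-⊹ (c ∷ w) (d ∷ w′) zero    = refl
coeff-⊹ (c ∷ w) (d ∷ w′) (suc i) = coeff-⊹ w w′ i

coeff-× : ∀ c w i → coeff (c W.×ₘ w) i ≡ c * coeff w i
coeff-× zero    w i = refl
coeff-× (suc c) w i = trans (coeff-⊹ w (c W.×ₘ w) i) (cong (coeff w i +_) (coeff-× c w i))

unit : ℕ → Word
unit zero    = 1 ∷ []
unit (suc n) = 0 ∷ unit n

coeff-unit-≡ : ∀ n → coeff (unit n) n ≡ 1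
coeff-unit-≡ zero    = refl
coeff-unit-≡ (suc n) = coeff-unit-≡ n

coeff-unit-≢ : ∀ n i → i ≢ n → coeff (unit n) i ≡ 0
coeff-unit-≢ zero    zero    i≢ = contradiction refl i≢
coeff-unit-≢ zero    (suc i) i≢ = refl
coeff-unit-≢ (suc n) zero    i≢ = refl
coeff-unit-≢ (suc n) (suc i) i≢ = coeff-unit-≢ n i (i≢ ∘ cong suc)

unpair : ℕ → ℕ × ℕ
unpair zero    = 0 , 0
unpair (suc n) with unpair n
... | zero  , b = suc b , 0
... | suc a , b = a , suc b

-- Induction along the walk on the antidiagonals: `(suc a , 0)` is preceded by `(0 , a)`, the last
-- pair of the previous diagonal.
unpair-surjective : ∀ a b → ∃ λ n → unpair n ≡ (a , b)
unpair-surjective a b = diagonal (a + b) a b refl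
  where
  diagonal : ∀ s a b → a + b ≡ s → ∃ λ n → unpair n ≡ (a , b)
  diagonal zero    zero    zero    _ = 0 , refl
  diagonal (suc s) (suc a) zero    e with diagonal s zero a (ℕ.suc-injective (trans (sym (ℕ.+-identityʳ _)) e))
  ... | n , p = suc n , aux n p
    where
    aux : ∀ n → unpair n ≡ (0 , a) → unpair (suc n) ≡ (suc a , 0)
    aux n p rewrite p = refl
  diagonal s a (suc b) e with diagonal s (suc a) b (trans (sym (ℕ.+-suc a b)) e)
  ... | n , p = suc n , aux n p
    where
    aux : ∀ n → unpair n ≡ (suc a , b) → unpair (suc n) ≡ (a , suc b)
    aux n p rewrite p = refl

decodeWord : ℕ → ℕ → Word
decodeWord zero    _ = []
decodeWord (suc l) n = proj₁ (unpair n) ∷ decodeWord l (proj₂ (unpair n))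

words : Surjection Word
words = (λ n → decodeWord (proj₁ (unpair n)) (proj₂ (unpair n))) , λ w →
  let l , n , p = code w ; m , q = unpair-surjective l n in
  m , trans (cong₂ decodeWord (cong proj₁ q) (cong proj₂ q)) p
  where
  code : ∀ w → ∃ λ l → ∃ λ n → decodeWord l n ≡ w
  code []      = 0 , 0 , refl
  code (c ∷ w) =
    let l , n , p = code w ; m , q = unpair-surjective c n in
    suc l , m , cong₂ _∷_ (cong proj₁ q) (trans (cong (decodeWord l ∘ proj₂) q) p)

-- Words supported in blocks

module Supports (N : ℕ → ℕ) where
  open W using (_×ₘ_)

  -- The bound on the coefficients keeps the value of the word near `e`; a nonzero coefficient makes
  -- the value exist in a semigroup that may lack an identity.
  record Block (n b : ℕ) (w : Word) : Set where
    field
      bounded : ∀ i → coeff w i ≤ N i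
      below   : ∀ i → i < n → coeff w i ≡ 0
      above   : ∀ i → b ≤ i → coeff w i ≡ 0
      nonzero : ∃ λ i → 1 ≤ coeff w i
  open Block

  block-mono : ∀ {m n b w} → m ≤ n → Block n b w → Block m b w
  block-mono m≤n z = record { bounded = bounded z ; above = above z ; nonzero = nonzero z
                            ; below = λ i i<m → below z i (ℕ.<-≤-trans i<m m≤n) }

  block-≤ : ∀ {n b w} → Block n b w → n ≤ b
  block-≤ {n} {b} {w} z with nonzero z
  ... | i , p with ℕ.<-≤-connex i n | ℕ.<-≤-connex i b
  ...   | inj₁ i<n | _        = contradiction (subst (1 ≤_) (below z i i<n) p) λ ()
  ...   | inj₂ n≤i | inj₁ i<b = ℕ.≤-trans n≤i (ℕ.<⇒≤ i<b)
  ...   | inj₂ _   | inj₂ b≤i = contradiction (subst (1 ≤_) (above z i b≤i) p) λ ()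

  -- The supports are disjoint, so at each position one of the coefficients vanishes and the bound
  -- survives.
  block-⊹ : ∀ {n m b w w′} → Block n m w → Block m b w′ → Block n b (w ⊹ w′)
  block-⊹ {n} {m} {b} {w} {w′} z z′ = record
    { bounded = λ i → subst (_≤ N i) (sym (coeff-⊹ w w′ i)) (bound i)
    ; below   = λ i i<n → trans (coeff-⊹ w w′ i) (cong₂ _+_ (below z i i<n) (below z′ i (ℕ.<-≤-trans i<n (block-≤ z))))
    ; above   = λ i b≤i → trans (coeff-⊹ w w′ i) (cong₂ _+_ (above z i (ℕ.≤-trans (block-≤ z′) b≤i)) (above z′ i b≤i))
    ; nonzero = let i , p = nonzero z in i , subst (1 ≤_) (sym (coeff-⊹ w w′ i)) (ℕ.≤-trans p (ℕ.m≤m+n _ _))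
    }
    where
    bound : ∀ i → coeff w i + coeff w′ i ≤ N i
    bound i with ℕ.<-≤-connex i m
    ... | inj₁ i<m = subst (_≤ N i) (sym (trans (cong (coeff w i +_) (below z′ i i<m)) (ℕ.+-identityʳ _))) (bounded z i)
    ... | inj₂ m≤i = subst (_≤ N i) (sym (cong (_+ coeff w′ i) (above z i m≤i))) (bounded z′ i)

  block-unit : ∀ {n c} → 1 ≤ c → c ≤ N n → Block n (suc n) (c ×ₘ unit n)
  block-unit {n} {c} 1≤c c≤N = record
    { bounded = bound
    ; below   = λ i i<n → vanish i (ℕ.<⇒≢ i<n)
    ; above   = λ i n<i → vanish i (≢-sym (ℕ.<⇒≢ n<i))
    ; nonzero = n , subst (1 ≤_) (sym value) 1≤c
    }
    where
    value : coeff (c ×ₘ unit n) n ≡ c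
    value = trans (coeff-× c (unit n) n) (trans (cong (c *_) (coeff-unit-≡ n)) (ℕ.*-identityʳ c))
    vanish : ∀ i → i ≢ n → coeff (c ×ₘ unit n) i ≡ 0
    vanish i i≢ = trans (coeff-× c (unit n) i) (trans (cong (c *_) (coeff-unit-≢ n i i≢)) (ℕ.*-zeroʳ c))
    bound : ∀ i → coeff (c ×ₘ unit n) i ≤ N i
    bound i with i ℕ.≟ n
    ... | yes refl = subst (_≤ N n) (sym value) c≤N
    ... | no i≢    = subst (_≤ N i) (sym (vanish i i≢)) z≤n

-- The filter of rich sets

module RichFilter (em : ∀ {a} → ExcludedMiddle a) (u v : ℕ → ℕ) (B : (t : ℕ) → Matrix (u t) (v t))
                  (row : ∀ t → Fin (u t)) (bound : ℕ → ℕ)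
                  (ladder : ∀ n → Ladders.Ladder em u v B n n (bound n)) where
  open Classical em
  open W
  open ClosedFilters em _⊹_

  open Supports bound public

  Image : (t i b : ℕ) → Pred Word 0ℓ → (Fin (v t) → Word) → Set
  Image t i b P x = (∀ j → Block i b (x j)) × (∀ k → Block i b (linear (B t k) x) × P (linear (B t k) x))

  record Good (i : ℕ) (P : Pred Word 0ℓ) : Set where
    constructor good
    field
      image : ∀ t → t ≤ i → ∃ λ b → ∃ λ x → Image t i b P x
  open Good public

  good-mono : ∀ {i i′ P Q} → i ≤ i′ → P ⊆ Q → Good i′ P → Good i Q
  good-mono i≤i′ s g = good λ t t≤i →
    let b , x , z , m = image g t (ℕ.≤-trans t≤i i≤i′) in
    b , x , (λ j → block-mono i≤i′ (z j)) , λ k → block-mono i≤i′ (proj₁ (m k)) , s (proj₂ (m k))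

  -- All words are multiples of one unit. Its position is `i ⊔ r` because the ladder there serves
  -- the matrices up to `i` and colourings with `r` colours, and fits under the bound at that
  -- position.
  good-colour : ∀ i r (γ : Word → ℕ) → (∀ w → γ w < r) → ∃ λ κ → Good i (λ w → γ w ≡ κ)
  good-colour i r γ γ< with ladder (i ⊔ r) (λ c → γ (c ×ₘ unit (i ⊔ r)))
                              (λ c → ℕ.<-≤-trans (γ< _) (ℕ.m≤n⊔m i r))
  ... | κ , images = κ , good-mono (ℕ.m≤m⊔n i r) id (good γ-image)
    where
    γ-image : ∀ t → t ≤ i ⊔ r → ∃ λ b → ∃ λ x → Image t (i ⊔ r) b (λ w → γ w ≡ κ) x
    γ-image t t≤ with images t t≤
    ... | x , (x≥1 , m) , x≤ , m≤ = suc (i ⊔ r) , (λ j → x j ×ₘ unit (i ⊔ r)) , (λ j → block-unit (x≥1 j) (x≤ j)) ,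
      λ k → subst (λ w → Block (i ⊔ r) (suc (i ⊔ r)) w × γ w ≡ κ) (sym (linear-multiples (B t k) x (unit (i ⊔ r))))
              (block-unit (proj₁ (m k)) (m≤ k) , proj₂ (m k))

  -- Sets that are not good need not be closed under unions, hence the finite partitions.
  record Poor (P : Pred Word 0ℓ) : Set where
    field
      order   : ℕ
      colours : ℕ
      colour  : Word → ℕ
      colour< : ∀ w → colour w < colours
      bad     : ∀ κ → ¬ Good order (λ w → P w × colour w ≡ κ)
  open Poor

  poor-⊆ : ∀ {P Q} → P ⊆ Q → Poor Q → Poor P
  poor-⊆ s p = record { order = order p ; colours = colours p ; colour = colour p ; colour< = colour< p
                      ; bad = λ κ g → bad p κ (good-mono ℕ.≤-refl (λ (a , e) → s a , e) g) }

  -- A word outside `P ∩ Q` but in `P` is outside `Q`. The colours of `q` are moved past those of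
  -- `p`, so each class lies in a class of one of the two partitions.
  poor-∁-∩ : ∀ {P Q} → Poor (∁ P) → Poor (∁ Q) → Poor (∁ (P ∩ Q))
  poor-∁-∩ {P} {Q} p q = record
    { order   = order p ⊔ order q
    ; colours = colours p + colours q
    ; colour  = λ w → γ w (em {P = P w})
    ; colour< = λ w → γ< w (em {P = P w})
    ; bad     = λ κ g → bad-∩ κ g (ℕ.<-≤-connex κ (colours p))
    }
    where
    γ : ∀ w → Dec (P w) → ℕ
    γ w (yes _) = colours p + colour q w
    γ w (no _)  = colour p w

    γ< : ∀ w d → γ w d < colours p + colours q
    γ< w (yes _) = ℕ.+-monoʳ-< (colours p) (colour< q w)
    γ< w (no _)  = ℕ.<-≤-trans (colour< p w) (ℕ.m≤m+n _ _)

    left : ∀ {κ} → κ < colours p → ∀ {w} → ∁ (P ∩ Q) w → (d : Dec (P w)) → γ w d ≡ κ → ∁ P w × colour p w ≡ κ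
    left κ< ¬pq (yes _) refl = contradiction κ< (ℕ.≤⇒≯ (ℕ.m≤m+n _ _))
    left κ< ¬pq (no ¬p) e    = ¬p , e

    right : ∀ {κ} → colours p ≤ κ → ∀ {w} → ∁ (P ∩ Q) w → (d : Dec (P w)) → γ w d ≡ κ →
            ∁ Q w × colour q w ≡ κ ∸ colours p
    right κ≥ ¬pq     (yes a) e    = (λ b → ¬pq (a , b)) , sym (trans (cong (_∸ colours p) (sym e)) (ℕ.m+n∸m≡n (colours p) _))
    right κ≥ {w} ¬pq (no _)  refl = contradiction (colour< p w) (ℕ.≤⇒≯ κ≥)

    bad-∩ : ∀ κ → Good (order p ⊔ order q) (λ w → ∁ (P ∩ Q) w × γ w em ≡ κ) → _ → _
    bad-∩ κ g (inj₁ κ<) = bad p κ (good-mono (ℕ.m≤m⊔n _ _) (λ (a , e) → left κ< a em e) g)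
    bad-∩ κ g (inj₂ κ≥) = bad q _ (good-mono (ℕ.m≤n⊔m (order p) _) (λ (a , e) → right κ≥ a em e) g)

  rich : Filter Word
  rich = record
    { Mem       = λ P → Lift (lsuc 0ℓ) (Poor (∁ P))
    ; upward    = λ s (lift p) → lift (poor-⊆ (λ ¬q p → ¬q (s p)) p)
    ; full      = lift (record { order = 0 ; colours = 1 ; colour = λ _ → 0 ; colour< = λ _ → s≤s z≤n
                               ; bad = λ κ g → let _ , _ , _ , m = image g 0 z≤n in proj₁ (proj₂ (m (row 0))) tt })
    ; meet      = λ (lift p) (lift q) → lift (poor-∁-∩ p q)
    ; inhabited = λ (lift p) → dne λ empty →
        let κ , g = good-colour (order p) (colours p) (colour p) (colour< p) in
        bad p κ (good-mono ℕ.≤-refl (λ {w} e → (λ a → empty (w , a)) , e) g)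
    }

  -- Were `P` not good at `i`, the partition into one piece would show it poor, and its complement
  -- would be a member disjoint from it.
  positive⇒good : ∀ {P} → Positive rich P → ∀ i → Good i P
  positive⇒good pos i = dne λ ¬g →
    let w , ¬p , p = pos _ (lift (record { order = i ; colours = 1 ; colour = λ _ → 0 ; colour< = λ _ → s≤s z≤n
                                      ; bad = λ κ g → ¬g (good-mono ℕ.≤-refl (λ (¬¬p , _) → dne ¬¬p) g) }))
    in ¬p p

  -- The sum of two images in consecutive blocks is an image.
  good-⊹ : ∀ {P} (G : Filter Word) → rich ≼ G → (Q : Pred Word 0ℓ) → (∀ {w} → Q w → Mem G (λ w′ → P (w ⊹ w′))) →
           ∀ i → Good i Q → Good i P
  good-⊹ {P} G rich≼G Q shift i g = good images
    where
    images : ∀ t → t ≤ i → ∃ λ b → ∃ λ x → Image t i b P x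
    images t t≤i with image g t t≤i
    ... | b , x , zx , mx with image (positive⇒good (Positive-≼ {F = rich} {G} rich≼G
          (meet-All G (λ k w′ → P (linear (B t k) x ⊹ w′)) (allFin (u t)) (λ k _ → shift (proj₂ (mx k))))) b) t
          (ℕ.≤-trans t≤i (block-≤ (proj₁ (mx (row t)))))
    ... | b′ , y , zy , my = b′ , (λ j → x j ⊹ y j) , (λ j → block-⊹ (zx j) (zy j)) , λ k →
      subst (λ w → Block i b′ w × P w) (sym (linear-∙ (B t k) x y))
        (block-⊹ (proj₁ (mx k)) (proj₁ (my k)) , proj₂ (my k) k (∈-allFin k))

  -- Let `δ` be 0 on `P` and the successor of the colour elsewhere, and colour `w` by the limit of
  -- `δ (w ⊹ w′)` as `w′` moves along an extension of `G`. If a nonzero limit had a good class,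
  -- adding images would make a class of the complement of `P` good. Hence the words with limit 0
  -- form a rich set.
  closed-rich : Closed rich
  closed-rich {P} (lift p) G rich≼G = shifts (decide words (λ w w′ → δ (w ⊹ w′) em) (suc (colours p)) (λ w w′ → δ< _ em) G)
    where
    δ : ∀ w → Dec (P w) → ℕ
    δ w (yes _) = 0
    δ w (no _)  = suc (colour p w)

    δ< : ∀ w d → δ w d < suc (colours p)
    δ< w (yes _) = s≤s z≤n
    δ< w (no _)  = s≤s (colour< p w)

    δ-zero : ∀ w d → δ w d ≡ 0 → P w
    δ-zero w (yes a) _ = a

    δ-suc : ∀ {κ} w d → δ w d ≡ suc κ → ∁ P w × colour p w ≡ κ
    δ-suc w (no ¬a) refl = ¬a , refl

    shifts : (∃ λ H → G ≼ H × Σ (Word → ℕ) λ φ → ∀ w → Mem H (λ w′ → δ (w ⊹ w′) em ≡ φ w)) → Shifts rich P G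
    shifts (H , G≼H , φ , d) = H , (λ {Q} → G≼H {Q}) , (λ w → φ w ≡ 0) ,
      lift (record { order = order p ; colours = suc (colours p) ; colour = φ ; colour< = φ< ; bad = bad-φ }) ,
      λ {w} e → upward H (λ {w′} e′ → δ-zero (w ⊹ w′) em (trans e′ e)) (d w)
      where
      φ< : ∀ w → φ w < suc (colours p)
      φ< w = let w′ , e = inhabited H (d w) in subst (_< suc (colours p)) e (δ< (w ⊹ w′) em)

      bad-φ : ∀ κ → ¬ Good (order p) (λ w → ¬ (φ w ≡ 0) × φ w ≡ κ)
      bad-φ zero    g = let _ , _ , _ , m = image g 0 z≤n ; ≢0 , ≡0 = proj₂ (m (row 0)) in ≢0 ≡0
      bad-φ (suc κ) g = bad p κ (good-mono ℕ.≤-refl (λ {w} → δ-suc w em)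
        (good-⊹ H (λ m → G≼H (rich≼G m)) (λ w → φ w ≡ suc κ)
          (λ {w} e → upward H (λ e′ → trans e′ e) (d w)) (order p) (good-mono ℕ.≤-refl proj₂ g)))

-- Compressed forms and the greedy construction

module _ {A : Set} (_≟_ : DecidableEquality A) where

  derun-head : ∀ y ys → ∃ λ zs → derun _≟_ (y ∷ ys) ≡ y ∷ zs
  derun-head y []       = [] , refl
  derun-head y (z ∷ ys) with y ≟ z
  ... | yes refl = derun-head y ys
  ... | no _     = _ , refl

  derun-∷ : ∀ x xs → (∃ λ ys → derun _≟_ (x ∷ xs) ≡ x ∷ ys × derun _≟_ xs ≡ x ∷ ys) ⊎
            derun _≟_ (x ∷ xs) ≡ x ∷ derun _≟_ xs
  derun-∷ x []       = inj₂ refl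
  derun-∷ x (y ∷ xs) with x ≟ y
  ... | yes refl = let ys , e = derun-head x xs in inj₁ (ys , e , e)
  ... | no _     = inj₂ refl

-- The first case is a coefficient that the next nonzero one repeats, the second a coefficient that
-- ends its run; they match the two `moves`.
compress-suc : ∀ c cs → let c⁺ = suc c in
  (∃ λ as → compress (c⁺ ∷ cs) ≡ c⁺ ∷ as × compress cs ≡ c⁺ ∷ as) ⊎ compress (c⁺ ∷ cs) ≡ c⁺ ∷ compress cs
compress-suc c cs = derun-∷ _≟_ (suc c) (filter (λ n → ¬? (n ≟ 0)) cs)

-- The sum of the compressed form is a crude bound, but the same for all rows of a Milliken-Taylor
-- matrix.
compress-≤ : ∀ cs → All (_≤ sumₗ (compress cs)) cs
compress-≤ []           = []
compress-≤ (zero  ∷ cs) = z≤n ∷ compress-≤ cs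
compress-≤ (suc c ∷ cs) with compress-suc c cs
... | inj₁ (as , e , e′) rewrite e = ℕ.m≤m+n (suc c) _ ∷ subst (λ as → All (_≤ sumₗ as) cs) e′ (compress-≤ cs)
... | inj₂ e             rewrite e = ℕ.m≤m+n (suc c) _ ∷ All.map (λ p → ℕ.≤-trans p (ℕ.m≤n+m _ (suc c))) (compress-≤ cs)

compress-nonempty : ∀ {a as} cs → compress cs ≡ a ∷ as → Any (1 ≤_) cs
compress-nonempty []           ()
compress-nonempty (zero  ∷ cs) e = there (compress-nonempty cs e)
compress-nonempty (suc c ∷ cs) e = here (s≤s z≤n)

combination : (ℕ → Word) → ℕ → List ℕ → Word
combination h t []       = []
combination h t (c ∷ cs) = c W.×ₘ h t ⊹ combination h (suc t) cs

module Construction (em : ∀ {a} → ExcludedMiddle a) (u v : ℕ → ℕ) (B : (t : ℕ) → Matrix (u t) (v t))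
                    (row : ∀ t → Fin (u t)) (bound : ℕ → ℕ)
                    (ladder : ∀ n → Ladders.Ladder em u v B n n (bound n)) where
  open W
  open ClosedFilters em _⊹_
  open RichFilter em u v B row bound ladder

  shift : ℕ → Word → Word → Word
  shift a w x = w ⊹ a ×ₘ x

  shift-assoc : ∀ a w x y → shift a (shift a w x) y ≡ shift a w (x ⊹ y)
  shift-assoc a w x y = trans (⊹-assoc w (a ×ₘ x) (a ×ₘ y)) (cong (w ⊹_) (sym (×-distrib-+ x y a)))

  module _ (χ : Word → ℕ) where

    -- For an ultrafilter p above F, ψ w is the limit of χ (w ⊹ a₀ x₀ ⊹ ⋯ ⊹ aₗ xₗ) as first xₗ, then xₗ₋₁, …,
    -- and finally x₀ tend to p.
    data Tower (F : Filter Word) : List ℕ → (Word → ℕ) → Set₁ where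
      base : Tower F [] χ
      step : ∀ {a as φ ψ} → Tower F as φ → IsLimit words (shift a) (shift-assoc a) F φ ψ → Tower F (a ∷ as) ψ

    tower-≼ : ∀ {F G as ψ} → F ≼ G → Tower F as ψ → Tower G as ψ
    tower-≼ F≼G base           = base
    tower-≼ F≼G (step tower l) = step (tower-≼ F≼G tower) (λ w → F≼G (l w))

    TowerOver : Filter Word → ℕ → List ℕ → Set₂
    TowerOver F r as = ∃ λ G → Closed G × F ≼ G × Σ (Word → ℕ) λ ψ → (∀ w → ψ w < r) × Tower G as ψ

    tower-exists : ∀ F → Closed F → ∀ r → (∀ w → χ w < r) → ∀ as → TowerOver F r as
    tower-exists F cF r χ< []       = F , cF , id , χ , χ< , base
    tower-exists F cF r χ< (a ∷ as) = extend (tower-exists F cF r χ< as)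
      where
      extend : TowerOver F r as → TowerOver F r (a ∷ as)
      extend (G , cG , F≼G , φ , φ< , tower) = extend′ (limit-exists words (shift a) (shift-assoc a) G cG r φ φ<)
        where
        extend′ : (∃ λ H → Closed H × G ≼ H × Σ (Word → ℕ) λ ψ → (∀ w → ψ w < r) ×
                   IsLimit words (shift a) (shift-assoc a) H φ ψ) → TowerOver F r (a ∷ as)
        extend′ (H , cH , G≼H , ψ , ψ< , l) =
          H , cH , (λ m → G≼H (F≼G m)) , ψ , ψ< , step (tower-≼ {G} {H} G≼H tower) l

    -- The coefficients still to be used, the current one first, and the sum so far.
    State : Set
    State = List ℕ × Word

    -- The current coefficient is used and then either kept for a further block or finished; a zero
    -- coefficient leaves the state as it is.
    moves : State → Word → List State
    moves ([]     , w) x = []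
    moves (a ∷ as , w) x = (a ∷ as , shift a w x) ∷ (as , shift a w x) ∷ []

    module Greedy (F : Filter Word) (rich≼F : rich ≼ F) (κ n₀ : ℕ) where

      Live : State → Set₁
      Live (as , w) = Σ (Word → ℕ) λ ψ → Tower F as ψ × ψ w ≡ κ

      LiveAll : List State → Set₁
      LiveAll T = ∀ σ → σ ∈ₗ T → Live σ

      Safe : Pred Word 0ℓ → List State → Set₁
      Safe Q T = ∀ {x} → Q x → ∀ {σ} → σ ∈ₗ T → LiveAll (moves σ x)

      -- The two halves of `IsLimit` guard the two moves: the recurrence of `ψ` keeps the tower, and
      -- the convergence of `φ` to `ψ` takes one level off.
      safe-state : ∀ σ → Live σ → ∃ λ Q → Mem F Q × (∀ {x} → Q x → LiveAll (moves σ x))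
      safe-state ([]     , w) _                      = _ , full F , λ _ _ ()
      safe-state (a ∷ as , w) (ψ , step tower l , e) = _ , l w , λ
        { (p , q) _ (here refl)         → ψ , step tower l , trans q e
        ; (p , q) _ (there (here refl)) → _ , tower , trans p e
        }

      safe-set : ∀ T → LiveAll T → ∃ λ Q → Mem F Q × Safe Q T
      safe-set []      live = _ , full F , λ _ ()
      safe-set (σ ∷ T) live with safe-state σ (live σ (here refl)) | safe-set T (λ τ i → live τ (there i))
      ... | Q , m , s | R , m′ , s′ = Q ∩ R , meet F m m′ , λ { (q , r) (here refl) → s q ; (q , r) (there i) → s′ r i }

      successors : List State → ∀ t → (Fin (v t) → Word) → List State
      successors T t x = T ++ concatMap (λ σ → concatMap (λ k → moves σ (linear (B t k) x)) (allFin (u t))) T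

      image-block : ∀ T → LiveAll T → ∀ t → ∃ λ b → ∃ λ x → ∃ λ Q → Image t (n₀ + t) b Q x × Safe Q T
      image-block T live t with safe-set T live
      ... | Q , m , s with image (positive⇒good (Positive-≼ {F = rich} {F} rich≼F m) (n₀ + t)) t (ℕ.m≤n+m t n₀)
      ...   | b , x , i = b , x , Q , i , s

      live-successors : ∀ T → LiveAll T → ∀ t x {b Q} → Image t (n₀ + t) b Q x → Safe Q T → LiveAll (successors T t x)
      live-successors T live t x (_ , m) s τ i with ∈-++⁻ T i
      ... | inj₁ i = live τ i
      ... | inj₂ i with find (∈-concatMap⁻ _ {xs = T} i)
      ...   | σ , σ∈ , i with find (∈-concatMap⁻ _ {xs = allFin (u t)} i)
      ...     | k , _ , i = s (proj₂ (m k)) σ∈ τ i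

      module _ (a : List ℕ) (ψ : Word → ℕ) (tower : Tower F a ψ) (start : ψ [] ≡ κ) where

        -- A stage holds the states reached under every choice of rows so far, so the vector chosen
        -- from it serves all rows of the insertion matrix at once.
        stage  : ∀ t → Σ (List State) LiveAll
        vector : ∀ t → Fin (v t) → Word
        vector t = proj₁ (proj₂ (image-block (proj₁ (stage t)) (proj₂ (stage t)) t))
        stage zero    = (a , []) ∷ [] , λ { _ (here refl) → ψ , tower , start }
        stage (suc t) = successors (proj₁ (stage t)) t (vector t) ,
          (let _ , _ , _ , i , s = image-block (proj₁ (stage t)) (proj₂ (stage t)) t in
           live-successors (proj₁ (stage t)) (proj₂ (stage t)) t (vector t) i s)

        vector-image : ∀ t → ∃ λ b → ∃ λ Q → Image t (n₀ + t) b Q (vector t)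
        vector-image t = let b , _ , Q , i , _ = image-block (proj₁ (stage t)) (proj₂ (stage t)) t in b , Q , i

        module _ (j : ∀ t → Fin (u t)) where

          entry : ℕ → Word
          entry t = linear (B t (j t)) (vector t)

          _∈ₛ_ : State → ℕ → Set
          σ ∈ₛ t = σ ∈ₗ proj₁ (stage t)

          wait : ∀ {σ} t → σ ∈ₛ t → σ ∈ₛ suc t
          wait t i = ∈-++⁺ˡ i

          move : ∀ {σ τ} t → σ ∈ₛ t → τ ∈ₗ moves σ (entry t) → τ ∈ₛ suc t
          move {σ} {τ} t i m = ∈-++⁺ʳ (proj₁ (stage t)) (∈-concatMap⁺ _ (lose i
            (∈-concatMap⁺ (λ k → moves σ (linear (B t k) (vector t))) (lose {P = λ k → τ ∈ₗ moves σ (linear (B t k) (vector t))}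
              (∈-allFin (j t)) m))))

          path : ∀ cs t {as w} → (as , w) ∈ₛ t → compress cs ≡ as →
                 ([] , w ⊹ combination entry t cs) ∈ₛ (length cs + t)
          path []           t i refl = subst (λ w → ([] , w) ∈ₛ t) (sym (⊹-identityʳ _)) i
          path (zero  ∷ cs) t {w = w} i e =
            subst (([] , w ⊹ combination entry (suc t) cs) ∈ₛ_) (ℕ.+-suc (length cs) t) (path cs (suc t) (wait t i) e)
          path (suc c ∷ cs) t {as} {w} i e =
            subst (([] , w ⊹ combination entry t (suc c ∷ cs)) ∈ₛ_) (ℕ.+-suc (length cs) t)
            (subst (λ w′ → ([] , w′) ∈ₛ (length cs + suc t)) (⊹-assoc w _ _) (continue (compress-suc c cs)))
            where
            w′ = shift (suc c) w (entry t)
            continue : _ → ([] , w′ ⊹ combination entry (suc t) cs) ∈ₛ (length cs + suc t)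
            continue (inj₁ (as′ , p , q)) =
              path cs (suc t) (move t (subst (λ as → (as , w) ∈ₛ t) (trans (sym e) p) i) (here refl)) q
            continue (inj₂ p) =
              path cs (suc t) (move t (subst (λ as → (as , w) ∈ₛ t) (trans (sym e) p) i) (there (here refl))) refl

          -- With no coefficients left the tower is `χ` itself, so a live state has colour `κ`.
          monochromatic : ∀ cs → compress cs ≡ a → χ (combination entry 0 cs) ≡ κ
          monochromatic cs e with proj₂ (stage (length cs + 0)) _ (path cs 0 (here refl) e)
          ... | _ , base , p = p

-- Concatenated blocks and values in the semigroup

module Blocks (v : ℕ → ℕ) where

  start : ℕ → ℕ
  start t = sumₗ (applyUpTo v t)

  position : ∀ t → Fin (v t) → ℕ
  position t k = start t + toℕ k

start-suc : ∀ v t → Blocks.start v (suc t) ≡ Blocks.start v t + v t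
start-suc v zero    = ℕ.+-identityʳ (v 0)
start-suc v (suc t) = trans (cong (v 0 +_) (start-suc (v ∘ suc) t)) (sym (ℕ.+-assoc (v 0) _ _))

module Flatten (v : ℕ → ℕ) (v≥1 : ∀ t → 1 ≤ v t) where
  open Blocks v

  start-mono : ∀ {t t′} → t ≤ t′ → start t ≤ start t′
  start-mono {t} {t′} t≤t′ with ℕ.m≤n⇒m<n∨m≡n t≤t′
  start-mono {t} {suc t′} _ | inj₁ t<t′ = ℕ.≤-trans (start-mono (ℕ.m<1+n⇒m≤n t<t′))
    (subst (start t′ ≤_) (sym (start-suc v t′)) (ℕ.m≤m+n _ _))
  ... | inj₂ refl = ℕ.≤-refl

  position< : ∀ {t t′} (k : Fin (v t)) → t < t′ → position t k < start t′
  position< {t} k t<t′ = ℕ.<-≤-trans (subst (position t k <_) (sym (start-suc v t)) (ℕ.+-monoʳ-< (start t) (toℕ<n k)))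
    (start-mono t<t′)

  position-injective : ∀ {t t′ k k′} → position t k ≡ position t′ k′ → (t , k) ≡ (t′ , k′)
  position-injective {t} {t′} {k} {k′} e with ℕ.<-cmp t t′
  ... | tri< t<t′ _ _ = contradiction (ℕ.<-≤-trans (position< k t<t′) (ℕ.m≤m+n _ _)) (ℕ.<-irrefl e)
  ... | tri> _ _ t′<t = contradiction (ℕ.<-≤-trans (position< k′ t′<t) (ℕ.m≤m+n _ _)) (ℕ.<-irrefl (sym e))
  ... | tri≈ _ refl _ = cong (t ,_) (toℕ-injective (ℕ.+-cancelˡ-≡ (start t) _ _ e))

  locate : ∀ n → Σ[ t ∈ ℕ ] Σ[ k ∈ Fin (v t) ] position t k ≡ n
  locate zero    = 0 , fromℕ< (v≥1 0) , toℕ-fromℕ< (v≥1 0)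
  locate (suc n) with locate n
  ... | t , k , e with ℕ.m≤n⇒m<n∨m≡n (toℕ<n k)
  ...   | inj₁ k⁺<v = t , fromℕ< k⁺<v , trans (cong (start t +_) (toℕ-fromℕ< k⁺<v)) (trans (ℕ.+-suc _ _) (cong suc e))
  ...   | inj₂ k⁺≡v = suc t , fromℕ< (v≥1 (suc t)) , trans (cong₂ _+_ (start-suc v t) (toℕ-fromℕ< (v≥1 (suc t))))
    (trans (ℕ.+-identityʳ _) (trans (cong (start t +_) (sym k⁺≡v)) (trans (ℕ.+-suc _ _) (cong suc e))))

  block-≥ : ∀ {N n} → start N ≤ n → N ≤ proj₁ (locate n)
  block-≥ {N} {n} N≤n with ℕ.<-≤-connex (proj₁ (locate n)) N
  ... | inj₂ N≤t = N≤t
  ... | inj₁ t<N = contradiction (ℕ.<-≤-trans (position< (proj₁ (proj₂ (locate n))) t<N) N≤n)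
                     (ℕ.<-irrefl (proj₂ (proj₂ (locate n))))

  flatten : ∀ {a} {A : Set a} → (∀ t → Fin (v t) → A) → ℕ → A
  flatten f n = f (proj₁ (locate n)) (proj₁ (proj₂ (locate n)))

  flatten-position : ∀ {a} {A : Set a} (f : ∀ t → Fin (v t) → A) t k → flatten f (position t k) ≡ f t k
  flatten-position f t k with locate (position t k)
  ... | t′ , k′ , e with refl ← position-injective {t′} {t} {k′} {k} e = refl

-- A matrix with a row but no columns has the image entry 0, which no class of positive integers
-- contains.
columns-nonempty : ∀ {u v} (M : Matrix u v) → ImagePartitionRegular M → Fin u → 1 ≤ v
columns-nonempty {v = suc v} M ipr k = s≤s z≤n
columns-nonempty {v = zero}  M ipr k
  with _ , _ , _ , m ← ipr 1 (s≤s z≤n) (λ _ → 1 ≤_) ((λ p → zero , p) , proj₂) with () ← m k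

module Totals {a} {A : Set a} {_∙_ : Op₂ A} {ε : A} (isCM : IsCommutativeMonoid _≡_ _∙_ ε) where
  open LinearForms isCM
  open IsCommutativeMonoid isCM using (identityˡ; assoc)

  total : List A → A
  total = foldr _∙_ ε

  total-+ : ∀ m n (g : ℕ → A) → total (applyUpTo g (m + n)) ≡ total (applyUpTo g m) ∙ total (applyUpTo (g ∘ (m +_)) n)
  total-+ zero    n g = sym (identityˡ _)
  total-+ (suc m) n g = trans (cong (g 0 ∙_) (total-+ m n (g ∘ suc))) (sym (assoc _ _ _))

  total-Fin : ∀ n (g : ℕ → A) → total (applyUpTo g n) ≡ sum {n} (g ∘ toℕ)
  total-Fin zero    g = refl
  total-Fin (suc n) g = cong (g 0 ∙_) (total-Fin n (g ∘ suc))

  total-blocks : ∀ N (v : ℕ → ℕ) (g h : ℕ → A) → (∀ t → sum (λ k → g (Blocks.position v t k)) ≡ h t) →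
                 total (applyUpTo g (Blocks.start v N)) ≡ total (applyUpTo h N)
  total-blocks zero    v g h eq = refl
  total-blocks (suc N) v g h eq = trans (total-+ (v 0) (Blocks.start (v ∘ suc) N) g) (cong₂ _∙_
    (trans (total-Fin (v 0) g) (eq 0))
    (total-blocks N (v ∘ suc) (g ∘ (v 0 +_)) (h ∘ suc) λ t →
      trans (sum-cong-≗ {v (suc t)} λ k → cong g (sym (ℕ.+-assoc (v 0) (Blocks.start (v ∘ suc) t) (toℕ k)))) (eq (suc t))))

module Values {ℓ} (T : SemitopologicalSemigroup ℓ) where
  open SemitopologicalSemigroup T

  module _ (comm : Commutative _≡_ _⊕_) where

    -- The empty sum acts as an identity adjoined to T.
    infixl 6 _⊕ₘ_
    _⊕ₘ_ : Op₂ (Maybe Carrier)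
    nothing ⊕ₘ m       = m
    just x  ⊕ₘ nothing = just x
    just x  ⊕ₘ just y  = just (x ⊕ y)

    ⊕ₘ-isCommutativeMonoid : IsCommutativeMonoid _≡_ _⊕ₘ_ nothing
    ⊕ₘ-isCommutativeMonoid = record
      { isMonoid = record
        { isSemigroup = record
          { isMagma = record { isEquivalence = isEquivalence ; ∙-cong = cong₂ _⊕ₘ_ }
          ; assoc   = ⊕ₘ-assoc
          }
        ; identity = (λ _ → refl) , λ { nothing → refl ; (just _) → refl }
        }
      ; comm = ⊕ₘ-comm
      }
      where
      ⊕ₘ-assoc : ∀ m m′ m″ → (m ⊕ₘ m′) ⊕ₘ m″ ≡ m ⊕ₘ (m′ ⊕ₘ m″)
      ⊕ₘ-assoc nothing  m′       m″       = refl
      ⊕ₘ-assoc (just x) nothing  m″       = refl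
      ⊕ₘ-assoc (just x) (just y) nothing  = refl
      ⊕ₘ-assoc (just x) (just y) (just z) = cong just (IsSemigroup.assoc isSemigroup x y z)
      ⊕ₘ-comm : ∀ m m′ → m ⊕ₘ m′ ≡ m′ ⊕ₘ m
      ⊕ₘ-comm nothing  nothing  = refl
      ⊕ₘ-comm nothing  (just y) = refl
      ⊕ₘ-comm (just x) nothing  = refl
      ⊕ₘ-comm (just x) (just y) = cong just (comm x y)

    open LinearForms ⊕ₘ-isCommutativeMonoid
    open Totals ⊕ₘ-isCommutativeMonoid
    open IsCommutativeMonoid ⊕ₘ-isCommutativeMonoid using (identityʳ) renaming (comm to ⊕ₘ-comm)

    ∑-∷ : ∀ x xs → ∑ T (x ∷ xs) ≡ just x ⊕ₘ ∑ T xs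
    ∑-∷ x []       = refl
    ∑-∷ x (y ∷ xs) = refl

    multiple-× : ∀ c x → multiple T c x ≡ c ×ₘ just x
    multiple-× zero    x = refl
    multiple-× (suc c) x = trans (∑-∷ x (replicate c x)) (cong (just x ⊕ₘ_) (multiple-× c x))

    ∑-mapMaybe : ∀ {A : Set} (f : A → Maybe Carrier) xs → ∑ T (mapMaybe f xs) ≡ total (map f xs)
    ∑-mapMaybe f []       = refl
    ∑-mapMaybe f (x ∷ xs) with f x
    ... | nothing = ∑-mapMaybe f xs
    ... | just y  = trans (∑-∷ y (mapMaybe f xs)) (cong (just y ⊕ₘ_) (∑-mapMaybe f xs))

    module _ (s : ℕ → Carrier) where

      value : ℕ → Word → Maybe Carrier
      value i []      = nothing
      value i (c ∷ w) = c ×ₘ just (s i) ⊕ₘ value (suc i) w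

      value-⊹ : ∀ i w w′ → value i (w ⊹ w′) ≡ value i w ⊕ₘ value i w′
      value-⊹ i []      w′       = refl
      value-⊹ i (c ∷ w) []       = sym (identityʳ _)
      value-⊹ i (c ∷ w) (d ∷ w′) = trans (cong₂ _⊕ₘ_ (×-homo-+ (just (s i)) c d) (value-⊹ (suc i) w w′))
        (interchange (c ×ₘ just (s i)) (d ×ₘ just (s i)) (value (suc i) w) _)
        where
        open import Algebra.Properties.CommutativeSemigroup
          (CommutativeMonoid.commutativeSemigroup monoid) using (interchange)

      value-× : ∀ c w → value 0 (c W.×ₘ w) ≡ c ×ₘ value 0 w
      value-× zero    w = refl
      value-× (suc c) w = trans (value-⊹ 0 w (c W.×ₘ w)) (cong (value 0 w ⊕ₘ_) (value-× c w))

      value-linear : ∀ {n} (m : Fin n → ℕ) x → value 0 (W.linear m x) ≡ linear m (value 0 ∘ x)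
      value-linear {zero}  m x = refl
      value-linear {suc n} m x = trans (value-⊹ 0 (m zero W.×ₘ x zero) _)
        (cong₂ _⊕ₘ_ (value-× (m zero) (x zero)) (value-linear (m ∘ suc) (x ∘ suc)))

    module Nearness (S : Subset Carrier) (S-closed : Subsemigroup T S) {e : Carrier} {𝓑 : ℕ → Subset Carrier}
                    (F : FProperty T e 𝓑) where
      open FProperty F

      Near : ℕ → Maybe Carrier → Set ℓ
      Near n nothing  = ⊤
      Near n (just y) = y ∈ S × y ∈ 𝓑 n

      near-≤ : ∀ {n n′} m → n ≤ n′ → Near n′ m → Near n m
      near-≤ m n≤n′ near with ℕ.m≤n⇒m<n∨m≡n n≤n′
      near-≤ nothing  _ _             | _ = _
      near-≤ (just y) _ near          | inj₂ refl = near
      near-≤ {n} {suc n′} (just y) _ (y∈S , y∈𝓑) | inj₁ n<n′ = near-≤ (just y) (ℕ.m<1+n⇒m≤n n<n′) (y∈S , decrease n′ y∈𝓑)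

      near-⊕ : ∀ {n} m m′ → Near (suc n) m → Near (suc n) m′ → Near n (m ⊕ₘ m′)
      near-⊕ nothing  m′       near near′ = near-≤ m′ (ℕ.n≤1+n _) near′
      near-⊕ (just y) nothing  near near′ = near-≤ (just y) (ℕ.n≤1+n _) near
      near-⊕ (just y) (just z) (y∈S , y∈𝓑) (z∈S , z∈𝓑) = S-closed y∈S z∈S , halve _ y∈𝓑 z∈𝓑

      -- Each addition costs one step in the base by `halve`, so `c` summands cost at most `c`
      -- steps.
      near-× : ∀ {n} c m → Near (n + c) m → Near n (c ×ₘ m)
      near-× zero    m near = _
      near-× {n} (suc c) m near = near-⊕ m (c ×ₘ m) (near-≤ m (ℕ.+-monoʳ-≤ 1 (ℕ.m≤m+n n c)) near′) (near-× c m near′)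
        where near′ = subst (λ k → Near k m) (ℕ.+-suc n c) near

      IsJust : Maybe Carrier → Set ℓ
      IsJust m = ∃ λ y → m ≡ just y

      just-⊕ˡ : ∀ {m} m′ → IsJust m → IsJust (m ⊕ₘ m′)
      just-⊕ˡ nothing  (y , refl) = y , refl
      just-⊕ˡ (just z) (y , refl) = y ⊕ z , refl

      just-⊕ʳ : ∀ m {m′} → IsJust m′ → IsJust (m ⊕ₘ m′)
      just-⊕ʳ m p = subst IsJust (⊕ₘ-comm _ m) (just-⊕ˡ m p)

      just-× : ∀ {c m} → 1 ≤ c → IsJust m → IsJust (c ×ₘ m)
      just-× {suc c} {m} _ p = just-⊕ˡ (c ×ₘ m) p

      module _ (s : ℕ → Carrier) (bound : ℕ → ℕ) (near-s : ∀ i → Near (suc i + bound i) (just (s i))) where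
        open Supports bound

        -- The point `s i` lies so deep that up to `bound i` copies of it stay in the member with
        -- index `suc i`. The tail lies there by induction, and one `halve` adds the two.
        value-bounded : ∀ i w → (∀ j → coeff w j ≤ bound (i + j)) → Near i (value s i w)
        value-bounded i []      b = _
        value-bounded i (c ∷ w) b = near-⊕ (c ×ₘ just (s i)) (value s (suc i) w)
          (near-× c (just (s i)) (near-≤ (just (s i))
            (ℕ.+-monoʳ-≤ (suc i) (subst (λ k → c ≤ bound k) (ℕ.+-identityʳ i) (b 0))) (near-s i)))
          (value-bounded (suc i) w λ j → subst (λ k → coeff w j ≤ bound k) (ℕ.+-suc i j) (b (suc j)))

        value-below : ∀ n i w → (∀ j → coeff w j ≤ bound (i + j)) → (∀ j → j < n → coeff w j ≡ 0) →
                      Near (n + i) (value s i w)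
        value-below zero    i w       b z = value-bounded i w b
        value-below (suc n) i []      b z = _
        value-below (suc n) i (c ∷ w) b z with refl ← z 0 (s≤s z≤n) =
          subst (λ k → Near k (value s (suc i) w)) (ℕ.+-suc n i)
            (value-below n (suc i) w (λ j → subst (λ k → coeff w j ≤ bound k) (ℕ.+-suc i j) (b (suc j)))
              λ j j<n → z (suc j) (s≤s j<n))

        value-just : ∀ i w j → 1 ≤ coeff w j → IsJust (value s i w)
        value-just i (c ∷ w) zero    p = just-⊕ˡ (value s (suc i) w) (just-× p (_ , refl))
        value-just i (c ∷ w) (suc j) p = just-⊕ʳ (c ×ₘ just (s i)) (value-just (suc i) w j p)

        block-value : ∀ {n b w} → Block n b w → Near n (value s 0 w) × IsJust (value s 0 w)
        block-value {n} {w = w} z =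
          subst (λ k → Near k (value s 0 w)) (ℕ.+-identityʳ n) (value-below n 0 w (Block.bounded z) (Block.below z)) ,
          value-just 0 w _ (proj₂ (Block.nonzero z))

-- Image partition regularity near `e`

module Main (em : ∀ {a} → ExcludedMiddle a) {ℓ} (T : SemitopologicalSemigroup ℓ) where
  open SemitopologicalSemigroup T
  open Values T

  module _ (comm : Commutative _≡_ _⊕_)
           (S : Subset Carrier) (dense : Dense S) (S-closed : Subsemigroup T S)
           (e : Carrier) (𝓑 : ℕ → Subset Carrier) (localBase : LocalBase T e 𝓑) (F : FProperty T e 𝓑)
           (u v : ℕ → ℕ) (B : (t : ℕ) → Matrix (u t) (v t)) (v≥1 : ∀ t → 1 ≤ v t)
           (row : ∀ t → Fin (u t)) (bound : ℕ → ℕ)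
           (ladder : ∀ n → Ladders.Ladder em u v B n n (bound n)) where

    open Nearness comm S S-closed F
    open LinearForms (⊕ₘ-isCommutativeMonoid comm)
    open Totals (⊕ₘ-isCommutativeMonoid comm)
    open Construction em u v B row bound ladder
    open RichFilter em u v B row bound ladder using (Block; rich; closed-rich)
    open Flatten v v≥1
    open Blocks v

    infixl 6 _+ₘ_
    _+ₘ_ : Op₂ (Maybe Carrier)
    _+ₘ_ = _⊕ₘ_ comm

    near-point : ∀ n → Satisfiable (λ y → y ∈ S × y ∈ 𝓑 n)
    near-point n =
      let V , openV , e∈V , V⊆𝓑 = proj₁ localBase n ; y , y∈V , y∈S = dense openV (e , e∈V) in y , y∈S , V⊆𝓑 y∈V

    s : ℕ → Carrier
    s i = proj₁ (near-point (suc i + bound i))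

    near-s : ∀ i → Near (suc i + bound i) (just (s i))
    near-s i = proj₂ (near-point (suc i + bound i))

    val : Word → Maybe Carrier
    val = value comm s 0

    -- Of the levels above `n + t`, `M` pay for the multiple by a coefficient and one pays for
    -- adding the tail.
    combination-near : ∀ n M (h : ℕ → Word) t cs → (∀ t → Near (n + suc t + M) (val (h t))) → All (_≤ M) cs →
                       Near (n + t) (val (combination h t cs))
    combination-near n M h t []       near []       = _
    combination-near n M h t (c ∷ cs) near (c≤ ∷ ≤M) = subst (Near (n + t)) (sym (value-⊹ comm s 0 (c W.×ₘ h t) _))
      (near-⊕ (val (c W.×ₘ h t)) (val (combination h (suc t) cs))
        (subst₂ Near (ℕ.+-suc n t) (sym (value-× comm s c (h t)))
          (near-× c (val (h t)) (near-≤ (val (h t)) (ℕ.+-monoʳ-≤ (n + suc t) c≤) (near t))))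
        (subst (λ k → Near k (val (combination h (suc t) cs))) (ℕ.+-suc n t) (combination-near n M h (suc t) cs near ≤M)))

    combination-just : ∀ (h : ℕ → Word) t cs → (∀ t → IsJust (val (h t))) → Any (1 ≤_) cs →
                       IsJust (val (combination h t cs))
    combination-just h t (c ∷ cs) p (here c≥1) = subst IsJust (sym (value-⊹ comm s 0 (c W.×ₘ h t) _))
      (just-⊕ˡ (val (combination h (suc t) cs)) (subst IsJust (sym (value-× comm s c (h t))) (just-× c≥1 (p t))))
    combination-just h t (c ∷ cs) p (there i) = subst IsJust (sym (value-⊹ comm s 0 (c W.×ₘ h t) _))
      (just-⊕ʳ (val (c W.×ₘ h t)) (combination-just h (suc t) cs p i))

    val-combination : ∀ N (c : ℕ → ℕ) (h : ℕ → Word) t (m : ℕ → Maybe Carrier) → (∀ i → m i ≡ val (h (t + i))) →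
                      val (combination h t (applyUpTo c N)) ≡ total (applyUpTo (λ i → c i ×ₘ m i) N)
    val-combination zero    c h t m eq = refl
    val-combination (suc N) c h t m eq = trans (value-⊹ comm s 0 (c 0 W.×ₘ h t) _) (cong₂ _+ₘ_
      (trans (value-× comm s (c 0) (h t)) (cong (c 0 ×ₘ_) (sym (trans (eq 0) (cong (val ∘ h) (ℕ.+-identityʳ t))))))
      (val-combination N (c ∘ suc) h (suc t) (m ∘ suc) λ i → trans (eq (suc i)) (cong (val ∘ h) (ℕ.+-suc t i))))

    module _ (r : ℕ) (1≤r : 1 ≤ r) (A : Fin r → Subset Carrier) (cover : S ≐ ⋃ (Fin r) A) where

      colourOf : ∀ y → Dec (y ∈ S) → ℕ
      colourOf y (yes y∈S) = toℕ (proj₁ (proj₁ cover y∈S))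
      -- Points outside `S` and words without a value get a default colour, legitimate since
      -- `1 ≤ r`; row entries will lie in `S`.
      colourOf y (no _)    = 0

      colour : Maybe Carrier → ℕ
      colour nothing  = 0
      colour (just y) = colourOf y em

      colour< : ∀ m → colour m < r
      colour< nothing  = 1≤r
      colour< (just y) with em {P = y ∈ S}
      ... | yes y∈S = toℕ<n (proj₁ (proj₁ cover y∈S))
      ... | no _    = 1≤r

      colour-sound : ∀ {y i} → y ∈ S → colour (just y) ≡ toℕ i → y ∈ A i
      colour-sound {y} y∈S p with em {P = y ∈ S}
      ... | no y∉S  = contradiction y∈S y∉S
      ... | yes y∈S = subst (λ i → y ∈ A i) (toℕ-injective p) (proj₂ (proj₁ cover y∈S))

      module _ (a₀ : ℕ) (as : List ℕ) (C D : ω×ω-Matrix) (mt : MillikenTaylor (a₀ ∷ as) C)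
               (ins : IsInsertionMatrix u v B C D)
               (G : Filter Word) (rich≼G : rich ≼ G) (ψ : Word → ℕ) (ψ< : ψ [] < r)
               (tower : Tower (colour ∘ val) G (a₀ ∷ as) ψ) where

        a : List ℕ
        a = a₀ ∷ as

        i₀ : Fin r
        i₀ = fromℕ< ψ<

        start≡ : ψ [] ≡ toℕ i₀
        start≡ = sym (toℕ-fromℕ< ψ<)

        module _ (n : ℕ) where
          n₀ : ℕ
          -- One level is for adding the tail and `sumₗ a` levels are for the multiples by
          -- coefficients, so that row entries end in the member with index `n`.
          n₀ = suc n + sumₗ a

          open Greedy (colour ∘ val) G rich≼G (toℕ i₀) n₀

          vec : ∀ t → Fin (v t) → Word
          vec = vector a ψ tower start≡

          ent : (j : ∀ t → Fin (u t)) → ℕ → Word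
          ent = entry a ψ tower start≡

          vec-value : ∀ t k → Near (n₀ + t) (val (vec t k)) × IsJust (val (vec t k))
          vec-value t k = let _ , _ , z , _ = vector-image a ψ tower start≡ t in
            block-value s bound near-s (z k)

          ent-value : ∀ j t → Near (n₀ + t) (val (ent j t)) × IsJust (val (ent j t))
          ent-value j t = let _ , _ , _ , m = vector-image a ψ tower start≡ t in
            block-value s bound near-s (proj₁ (m (j t)))

          point : ∀ t → Fin (v t) → Carrier
          point t k = proj₁ (proj₂ (vec-value t k))

          val-vec : ∀ t k → val (vec t k) ≡ just (point t k)
          val-vec t k = proj₂ (proj₂ (vec-value t k))

          point-near : ∀ t k → Near (n₀ + t) (just (point t k))
          point-near t k = subst (Near (n₀ + t)) (val-vec t k) (proj₁ (vec-value t k))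

          x : ℕ → Carrier
          x = flatten point

          x∈S : ∀ p → x p ∈ S
          x∈S p = proj₁ (point-near _ _)

          x⟶e : x ⟶ e
          x⟶e {V} V∈τ = let m , 𝓑⊆V = proj₂ localBase V∈τ in start m , λ p m≤p →
            𝓑⊆V (proj₂ (near-≤ (just (x p)) (ℕ.≤-trans (block-≥ m≤p) (ℕ.m≤n+m _ n₀)) (point-near _ _)))

          module _ (c d : ℕ → ℕ) (j : ∀ t → Fin (u t))
                   (concat : IsConcatenation v (λ t k → c t * B t (j t) k) d) where

            row-value : ∀ N → total (applyUpTo (λ p → multiple T (d p) (x p)) (start N)) ≡
                              val (combination (ent j) 0 (applyUpTo c N))
            row-value N = trans
              (total-blocks N v (λ p → multiple T (d p) (x p)) (λ t → c t ×ₘ val (ent j t)) block)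
              (sym (val-combination N c (ent j) 0 (val ∘ ent j) (λ _ → refl)))
              where
              block : ∀ t → sum (λ k → multiple T (d (position t k)) (x (position t k))) ≡ c t ×ₘ val (ent j t)
              block t = begin
                sum (λ k → multiple T (d (position t k)) (x (position t k))) ≡⟨ sum-cong-≗ {v t} (λ k →
                  trans (cong₂ (multiple T) (concat t k) (flatten-position point t k))
                    (trans (multiple-× comm (c t * B t (j t) k) (point t k))
                           (cong ((c t * B t (j t) k) ×ₘ_) (sym (val-vec t k))))) ⟩
                linear (λ k → c t * B t (j t) k) (val ∘ vec t) ≡⟨ linear-cong-× (c t) (B t (j t)) (val ∘ vec t) ⟩
                c t ×ₘ linear (B t (j t)) (val ∘ vec t)        ≡⟨ cong (c t ×ₘ_) (sym (value-linear comm s (B t (j t)) (vec t))) ⟩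
                c t ×ₘ val (ent j t)                           ∎
                where open ≡-Reasoning

            zeroFrom : ∀ N → ZeroFrom N c → ZeroFrom (start N) d
            zeroFrom N z p N≤p with locate p | block-≥ {N} N≤p
            ... | t , k , refl | N≤t = trans (concat t k) (cong (_* B t (j t) k) (z t N≤t))

            row-entry : HasCompressedForm c a → ∃ λ y → IsEntry T d x y × y ∈ A i₀ × y ∈ 𝓑 n
            row-entry (N , z , form) =
              y , (start N , zeroFrom N z , sum≡) , colour-sound (proj₁ near-y) mono , proj₂ near-y
              where
              cs = applyUpTo c N
              justw = combination-just (ent j) 0 cs (λ t → proj₂ (ent-value j t)) (compress-nonempty cs form)
              y = proj₁ justw
              near-y : Near n (just y)
              near-y = subst₂ Near (ℕ.+-identityʳ n) (proj₂ justw)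
                (combination-near n (sumₗ a) (ent j) 0 cs
                  (λ t → subst (λ k → Near k (val (ent j t))) (level t) (proj₁ (ent-value j t)))
                  (subst (λ a → All (_≤ sumₗ a) cs) form (compress-≤ cs)))
                where
                level : ∀ t → n₀ + t ≡ n + suc t + sumₗ a
                level t = trans (cong suc (trans (ℕ.+-assoc n (sumₗ a) t) (trans (cong (n +_) (ℕ.+-comm (sumₗ a) t))
                  (sym (ℕ.+-assoc n t (sumₗ a)))))) (cong (_+ sumₗ a) (sym (ℕ.+-suc n t)))
              mono : colour (just y) ≡ toℕ i₀
              mono = subst (λ m → colour m ≡ toℕ i₀) (proj₂ justw)
                (monochromatic a ψ tower start≡ j cs form)
              sum≡ : ∑ T (mapMaybe (λ p → multiple T (d p) (x p)) (upTo (start N))) ≡ just y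
              sum≡ = trans (∑-mapMaybe comm (λ p → multiple T (d p) (x p)) (upTo (start N)))
                (trans (cong total (map-upTo (λ p → multiple T (d p) (x p)) (start N))) (trans (row-value N) (proj₂ justw)))

        near-e : ∀ {V} → V ∈ τ e → Σ[ x ∈ (ℕ → Carrier) ] (∀ n → x n ∈ S) × x ⟶ e ×
                 (∀ k → ∃ λ y → IsEntry T (D k) x y × y ∈ A i₀ × y ∈ V)
        near-e V∈τ = let n , 𝓑⊆V = proj₂ localBase V∈τ in x n , x∈S n , (λ {V} → x⟶e n {V}) , λ k →
          let i , j , isRow = proj₁ ins k
              y , entry , y∈A , y∈𝓑 = row-entry n (C i) (D k) j isRow (proj₁ mt i)
          in y , entry , y∈A , 𝓑⊆V y∈𝓑

    conclusion : ∀ a₀ as (C D : ω×ω-Matrix) → MillikenTaylor (a₀ ∷ as) C → IsInsertionMatrix u v B C D → IPR/ T S e D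
    conclusion a₀ as C D mt ins r 1≤r A cover =
      finish (tower-exists χ rich closed-rich r (λ w → colour< r 1≤r A cover (val w)) (a₀ ∷ as))
      where
      χ : Word → ℕ
      χ = colour r 1≤r A cover ∘ val
      finish : TowerOver χ rich r (a₀ ∷ as) → Σ[ i ∈ Fin r ] (∀ {V} → V ∈ τ e →
        Σ[ x ∈ (ℕ → Carrier) ] (∀ n → x n ∈ S) × x ⟶ e × (∀ k → ∃ λ y → IsEntry T (D k) x y × y ∈ A i ∩ V))
      finish (G , _ , rich≼G , ψ , ψ< , tower) =
        -- The colour is read off `ψ []` before any neighbourhood is given, so it is the same for
        -- all of them.
        fromℕ< (ψ< []) , λ V∈τ → near-e r 1≤r A cover a₀ as C D mt ins G rich≼G ψ (ψ< []) tower V∈τ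

theorem3p8 : (∀ {a : Level} → ExcludedMiddle a) →
    {ℓ : Level} (T : SemitopologicalSemigroup ℓ) →
    let open SemitopologicalSemigroup T in
    Commutative _≡_ _⊕_ → Hausdorff →
    (S : Subset Carrier) → Dense S → Subsemigroup T S →
    (e : Carrier) → _IdempotentOn_ _≡_ _⊕_ e →
    (𝓑 : ℕ → Subset Carrier) → LocalBase T e 𝓑 → FProperty T e 𝓑 →
    (a : List ℕ) → All (1 ≤_) a → Compressed a → 1 < length a →
    (C : ω×ω-Matrix) → MillikenTaylor a C →
    (u v : ℕ → ℕ) (B : (t : ℕ) → Matrix (u t) (v t)) →
    (∀ t → ImagePartitionRegular (B t)) →
    (D : ω×ω-Matrix) → IsInsertionMatrix u v B C D →
    IPR/ T S e D
theorem3p8 em T comm _ S dense S-closed e _ 𝓑 localBase F (a₀ ∷ as) _ _ _ C mt u v B ipr D ins =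
  Main.conclusion em T comm S dense S-closed e 𝓑 localBase F u v B
    (λ t → columns-nonempty (B t) (ipr t) (row t)) row
    -- The bound at position `n` accounts for the matrices up to `n` and for `n` colours, so it is
    -- fixed before the number of classes of `S` is known.
    (λ n → proj₁ (ladder n n)) (λ n → proj₂ (ladder n n)) a₀ as C D mt ins
  where
  row : ∀ t → Fin (u t)
  -- The first row of `D` comes with a choice of a row in every `B t`, so each `B t` has one.
  row = proj₁ (proj₂ (proj₁ ins 0))
  ladder = Ladders.ladder em u v B ipr row
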